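{- Let $M\rightarrow M'$ be a matroid perspective on a finite linearly ordered set $E$, and let $p,q$ be non-negative integers. Then $$\frac{\partial^{p+q} t}{\partial x^p\,\partial y^q}(M,M';x,y,z)=p!\,q!\sum_{\substack{A\subseteq E\\ cr_{M'}(A)=p,\ nl_M(A)=q}} x^{\iota_{M'}(A)}\,y^{\epsilon_M(A)}\,z^{rcd_{M,M'}(A)}.$$
   Context: A matroid perspective $M\rightarrow M'$ is a pair of matroids $M,M'$ on the same finite set $E$ such that every circuit of $M$ is a union of circuits of $M'$ (equivalently, no circuit of $M$ and cocircuit of $M'$ intersect in exactly one element). For a matroid $N$ on $E$ with rank function $r_N$, $r(N)=r_N(E)$, and $A\subseteq E$: $cr_N(A)=r(N)-r_N(A)$, $nl_N(A)=|A|-r_N(A)$; $\mathrm{Ext}_N(A)$ is the set of $e\in E\setminus A$ that are the smallest element of some circuit of $N$ contained in $A\cup\{e\}$, $\epsilon_N(A)=|\mathrm{Ext}_N(A)|$; $\mathrm{Int}_N(A)$ is the set of $e\in A$ that are the smallest element of some cocircuit of $N$ contained in $(E\setminus A)\cup\{e\}$, $\iota_N(A)=|\mathrm{Int}_N(A)|$. The rank codrop is $rcd_{M,M'}(A)=r(M)-r(M')-(r_M(A)-r_{M'}(A))$. The Tutte polynomial of the perspective is $t(M,M';x,y,z)=\sum_{A\subseteq E}(x-1)^{r(M')-r_{M'}(A)}(y-1)^{|A|-r_M(A)}z^{rcd_{M,M'}(A)}$. -}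

module Defs where

open import Data.Bool using (Bool; true; false; not; _∧_; _∨_; if_then_else_)
open import Data.Nat as ℕ using (ℕ; zero; suc; _≤_; _+_; _∸_; _<ᵇ_; _≤ᵇ_; _≡ᵇ_)

open import Data.Integer as ℤ using (ℤ; +_)
open import Data.Fin using (Fin; toℕ)
open import Data.Fin.Subset using (Subset; _∈_; _⊆_; _∪_; _∩_; ∁; ⁅_⁆; ⊤; ∣_∣)
open import Data.Vec using (Vec; []; _∷_; lookup; zipWith; toList)
open import Data.List using (List; []; _∷_; map; _++_; foldr; allFin)
open import Data.Bool.ListAction using (and; all; any)
open import Data.Product using (Σ; _×_; _,_)
open import Relation.Binary.PropositionalEquality using (_≡_)

-- Finite ground set E = Fin n, linearly ordered by the natural order.
-- Subsets of E are Data.Fin.Subset.Subset n.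

subsets : (n : ℕ) → List (Subset n)
subsets zero    = [] ∷ []
subsets (suc n) = map (false ∷_) (subsets n) ++ map (true ∷_) (subsets n)

_∈ᵇ_ : {n : ℕ} → Fin n → Subset n → Bool
e ∈ᵇ A = lookup A e

_⊆ᵇ_ : {n : ℕ} → Subset n → Subset n → Bool
A ⊆ᵇ B = and (toList (zipWith (λ a b → not a ∨ b) A B))

_=ᵇ_ : {n : ℕ} → Subset n → Subset n → Bool
A =ᵇ B = (A ⊆ᵇ B) ∧ (B ⊆ᵇ A)

countB : {A : Set} → (A → Bool) → List A → ℕ
countB P []       = 0
countB P (x ∷ xs) = if P x then suc (countB P xs) else countB P xs

record Matroid (n : ℕ) : Set where
  field
    rank        : Subset n → ℕ
    rank-bound  : ∀ A → rank A ≤ ∣ A ∣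
    rank-mono   : ∀ A B → A ⊆ B → rank A ≤ rank B
    rank-submod : ∀ A B → rank (A ∪ B) + rank (A ∩ B) ≤ rank A + rank B
open Matroid public

module _ {n : ℕ} where

  r : Matroid n → ℕ
  r N = rank N ⊤

  dualRank : Matroid n → Subset n → ℕ
  dualRank N A = (∣ A ∣ + rank N (∁ A)) ∸ r N

  dependentR : (Subset n → ℕ) → Subset n → Bool
  dependentR ρ A = ρ A <ᵇ ∣ A ∣

  circuitR : (Subset n → ℕ) → Subset n → Bool
  circuitR ρ C = dependentR ρ C ∧
    all (λ B → not ((B ⊆ᵇ C) ∧ not (B =ᵇ C)) ∨ not (dependentR ρ B)) (subsets n)

  isCircuit : Matroid n → Subset n → Bool
  isCircuit N = circuitR (rank N)

  isCocircuit : Matroid n → Subset n → Bool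
  isCocircuit N = circuitR (dualRank N)

  smallestIn : Fin n → Subset n → Bool
  smallestIn e C = (e ∈ᵇ C) ∧ all (λ f → not (f ∈ᵇ C) ∨ (toℕ e ≤ᵇ toℕ f)) (allFin n)

  inExt : Matroid n → Subset n → Fin n → Bool
  inExt N A e = not (e ∈ᵇ A) ∧
    any (λ C → isCircuit N C ∧ (C ⊆ᵇ (A ∪ ⁅ e ⁆)) ∧ smallestIn e C) (subsets n)

  inInt : Matroid n → Subset n → Fin n → Bool
  inInt N A e = (e ∈ᵇ A) ∧
    any (λ D → isCocircuit N D ∧ (D ⊆ᵇ (∁ A ∪ ⁅ e ⁆)) ∧ smallestIn e D) (subsets n)

  ε : Matroid n → Subset n → ℕ
  ε N A = countB (inExt N A) (allFin n)

  ι : Matroid n → Subset n → ℕ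
  ι N A = countB (inInt N A) (allFin n)

  cr : Matroid n → Subset n → ℕ
  cr N A = r N ∸ rank N A

  nl : Matroid n → Subset n → ℕ
  nl N A = ∣ A ∣ ∸ rank N A

  -- rcd_{M,M'}(A) = r(M) − r(M') − (r_M(A) − r_{M'}(A))
  -- (non-negative for a perspective; computed as (r(M)+r_{M'}(A)) ∸ (r(M')+r_M(A)))
  rcd : Matroid n → Matroid n → Subset n → ℕ
  rcd M M' A = (r M + rank M' A) ∸ (r M' + rank M A)

  -- matroid perspective M → M': every circuit of M is a union of circuits of M'
  Perspective : Matroid n → Matroid n → Set
  Perspective M M' = ∀ C → isCircuit M C ≡ true → ∀ e → e ∈ C →
    Σ (Subset n) λ C' → (isCircuit M' C' ≡ true) × (e ∈ C') × (C' ⊆ C)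

-- Polynomials in ℤ[x,y,z], as coefficient functions
-- (coefficient of x^i y^j z^k); equality is coefficientwise.

Poly : Set
Poly = ℕ → ℕ → ℕ → ℤ

_≈ₚ_ : Poly → Poly → Set
f ≈ₚ g = ∀ i j k → f i j k ≡ g i j k

monoₚ : ℕ → ℕ → ℕ → ℤ → Poly
monoₚ i j k c a b d = if (a ≡ᵇ i) ∧ (b ≡ᵇ j) ∧ (d ≡ᵇ k) then c else + 0

0ₚ 1ₚ X Y Z : Poly
0ₚ = λ _ _ _ → + 0
1ₚ = monoₚ 0 0 0 (+ 1)
X  = monoₚ 1 0 0 (+ 1)
Y  = monoₚ 0 1 0 (+ 1)
Z  = monoₚ 0 0 1 (+ 1)

_+ₚ_ _-ₚ_ : Poly → Poly → Poly
(f +ₚ g) i j k = f i j k ℤ.+ g i j k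
(f -ₚ g) i j k = f i j k ℤ.- g i j k

sumTo : ℕ → (ℕ → ℤ) → ℤ
sumTo zero    h = h 0
sumTo (suc m) h = sumTo m h ℤ.+ h (suc m)

_*ₚ_ : Poly → Poly → Poly
(f *ₚ g) i j k =
  sumTo i λ a → sumTo j λ b → sumTo k λ c →
    f a b c ℤ.* g (i ∸ a) (j ∸ b) (k ∸ c)

_^ₚ_ : Poly → ℕ → Poly
f ^ₚ zero  = 1ₚ
f ^ₚ suc m = f *ₚ (f ^ₚ m)

_·ₚ_ : ℤ → Poly → Poly
(c ·ₚ f) i j k = c ℤ.* f i j k

Σₚ : {A : Set} → List A → (A → Poly) → Poly
Σₚ xs h = foldr (λ a acc → h a +ₚ acc) 0ₚ xs

∂x ∂y : Poly → Poly
∂x f i j k = + (suc i) ℤ.* f (suc i) j k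
∂y f i j k = + (suc j) ℤ.* f i (suc j) k

iter : ℕ → (Poly → Poly) → Poly → Poly
iter zero    D f = f
iter (suc m) D f = D (iter m D f)

module _ {n : ℕ} where
  tutte : Matroid n → Matroid n → Poly
  tutte M M' = Σₚ (subsets n) λ A →
    ((X -ₚ 1ₚ) ^ₚ (r M' ∸ rank M' A)) *ₚ
    (((Y -ₚ 1ₚ) ^ₚ (∣ A ∣ ∸ rank M A)) *ₚ (Z ^ₚ rcd M M' A))

  rhsSum : Matroid n → Matroid n → ℕ → ℕ → Poly
  rhsSum M M' p q = Σₚ (subsets n) λ A →
    if (cr M' A ≡ᵇ p) ∧ (nl M A ≡ᵇ q)
    then (X ^ₚ ι M' A) *ₚ ((Y ^ₚ ε M A) *ₚ (Z ^ₚ rcd M M' A))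
    else 0ₚ

{-# OPTIONS --safe #-}
module Submission where

-- By Taylor's formula in the auxiliary variables u and v, it suffices to show
--   ∑ (x+u-1)^cr (y+v-1)^nl z^rcd  =  ∑ u^cr v^nl x^ι y^ε z^rcd   (sums over A ⊆ E).
-- Both sides obey the same recursion when the greatest element f is deleted (f ∉ A) or contracted
-- (f ∈ A): since f is greatest, activities of the other elements pass to the minor, while f itself is
-- externally active only as a loop of M and internally active only as a coloop of M′.  A coloop of M′
-- gives the factor x + u, a loop of M the factor y + v, and otherwise the two minors are simply added,
-- with a factor z on the deletion if f is a coloop of M but not of M′.

open import Defs
open import Data.Bool using (Bool; true; false; T; if_then_else_; not; _∧_; _∨_)
open import Data.Bool.ListAction using (any)
open import Data.Bool.Properties using (∨-idem; ∧-idem; ∨-identityʳ; not-involutive; T-≡; T-∧)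
open import Data.Empty using (⊥-elim)
open import Data.Fin using (Fin; zero; suc; toℕ)
open import Data.Fin.Properties using (toℕ-injective)
open import Data.Fin.Subset using (Subset; _∈_; _∉_; _⊆_; _∪_; _∩_; _-_; ∁; ⁅_⁆; ⊤; ⊥; ∣_∣)
open import Data.Fin.Subset.Properties
open import Data.Integer as ℤ using (ℤ; -_; 0ℤ; 1ℤ)
import Data.Integer.Properties as ℤₚ
open import Data.Integer.Tactic.RingSolver using (solve-∀)
open import Data.List using (List; []; _∷_; map; _++_; tabulate; allFin)
open import Data.List.Membership.Propositional using () renaming (_∈_ to _∈ₗ_)
open import Data.List.Membership.Propositional.Properties using (∈-++⁺ˡ; ∈-++⁺ʳ; ∈-map⁺; ∈-allFin)
import Data.List.Relation.Unary.All as All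
import Data.List.Relation.Unary.All.Properties as Allₚ
import Data.List.Relation.Unary.Any as Any
import Data.List.Relation.Unary.Any.Properties as Anyₚ
open import Data.Nat using (ℕ; zero; suc; _+_; _*_; _∸_; _!; _≡ᵇ_; _≤_; _<_; z≤n; s≤s; s≤s⁻¹)
import Data.Nat.Properties as ℕₚ
import Data.Nat.Tactic.RingSolver as ℕ-Solver
open import Data.Product using (∃; _×_; _,_; proj₁; proj₂)
open import Data.Sum using (_⊎_; inj₁; inj₂)
open import Data.Vec using ([]; _∷_; _∷ʳ_; lookup; zipWith; here; there)
open import Data.Vec.Properties using ([]=⇒lookup; lookup⇒[]=; lookup-map)
open import Function using (_∘_; Equivalence)
open import Relation.Binary.PropositionalEquality using (_≡_; refl; sym; trans; cong; cong₂; subst; subst₂; _≗_; module ≡-Reasoning)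
open import Relation.Nullary using (¬_; Dec; yes; no)

open Equivalence using (to; from)

-- Taylor coefficients of (x - 1)ᵐ

-- Circuits are eliminated before the induction: activities become comparisons of ranks, and the
-- perspective becomes monotonicity of the difference of the two rank functions, a condition that
-- both minors inherit. The same inequality shapes the recursion: a coloop of M′ is a coloop of M,
-- and a loop of M is a loop of M′. In either case the rank functions of deletion and contraction
-- differ by one constant, which no statistic sees, so both minors carry the same sum. For a coloop
-- of M′ the left side multiplies that sum by (x+u-1) + 1, while on the right u records that
-- omitting f costs corank, and x that a chosen f is internally active; a loop of M is dual. The
-- variables u, v, x, y, z are kept as exponents p, q, i, j, k: multiplication by a variable is
-- `shift`, and the induction hypothesis is used at a lowered exponent.

δ : ℕ → ℕ → ℤ
δ zero    zero    = 1ℤ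
δ zero    (suc b) = 0ℤ
δ (suc a) zero    = 0ℤ
δ (suc a) (suc b) = δ a b

-- Multiplication of a power series by its variable, on coefficient sequences.
shift : (ℕ → ℤ) → ℕ → ℤ
shift f zero    = 0ℤ
shift f (suc n) = f n

shift-cong : ∀ {f g : ℕ → ℤ} → f ≗ g → shift f ≗ shift g
shift-cong f≗g zero    = refl
shift-cong f≗g (suc n) = f≗g n

shift-*ʳ : ∀ f c n → shift f n ℤ.* c ≡ shift (λ m → f m ℤ.* c) n
shift-*ʳ f c zero    = refl
shift-*ʳ f c (suc n) = refl

shift-*ˡ : ∀ c f n → c ℤ.* shift f n ≡ shift (λ m → c ℤ.* f m) n
shift-*ˡ c f zero    = ℤₚ.*-zeroʳ c
shift-*ˡ c f (suc n) = refl

δ-suc : ∀ a → δ (suc a) ≗ shift (δ a)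
δ-suc a zero    = refl
δ-suc a (suc b) = refl

-- The coefficient of uᵖxⁱ in (x + u - 1)ᵐ.
taylor : ℕ → ℕ → ℕ → ℤ
taylor zero    p i = δ 0 p ℤ.* δ 0 i
taylor (suc m) p i = shift (λ p → taylor m p i) p ℤ.+ shift (taylor m p) i ℤ.- taylor m p i

-- Adding the lower power cancels the -1 in x+u-1. This yields the factor x+u for a coloop and, in
-- the other pair of variables, y+v for a loop.
taylor-+ : ∀ m p i → taylor (suc m) p i ℤ.+ taylor m p i ≡ shift (λ p → taylor m p i) p ℤ.+ shift (taylor m p) i
taylor-+ m p i = lemma (shift (λ p → taylor m p i) p ℤ.+ shift (taylor m p) i) (taylor m p i)
  where
  lemma : ∀ a b → a ℤ.- b ℤ.+ b ≡ a
  lemma = solve-∀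

-- (x+u-1)ᵐ depends on x and u only through x+u, so its derivatives in x and in u agree.
taylor-∂ : ∀ m p i → ℤ.+ suc i ℤ.* taylor m p (suc i) ≡ ℤ.+ suc p ℤ.* taylor m (suc p) i
taylor-∂ zero p i = trans (cong (λ s → ℤ.+ suc i ℤ.* s) (ℤₚ.*-zeroʳ (δ 0 p)))
                      (trans (ℤₚ.*-zeroʳ (ℤ.+ suc i)) (sym (ℤₚ.*-zeroʳ (ℤ.+ suc p))))
taylor-∂ (suc m) p i = begin
    ℤ.+ suc i ℤ.* (shift (λ p → t p (suc i)) p ℤ.+ t p i ℤ.- t p (suc i))
  ≡⟨ expand (ℤ.+ suc i) (shift (λ p → t p (suc i)) p) (t p i) (t p (suc i)) ⟩
    ℤ.+ suc i ℤ.* shift (λ p → t p (suc i)) p ℤ.+ ℤ.+ suc i ℤ.* t p i ℤ.- ℤ.+ suc i ℤ.* t p (suc i)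
  ≡⟨ cong₂ (λ a b → a ℤ.+ ℤ.+ suc i ℤ.* t p i ℤ.- b) (left p) (taylor-∂ m p i) ⟩
    ℤ.+ p ℤ.* t p i ℤ.+ ℤ.+ suc i ℤ.* t p i ℤ.- ℤ.+ suc p ℤ.* t (suc p) i
  ≡⟨ cong (ℤ._- ℤ.+ suc p ℤ.* t (suc p) i) (swap (ℤ.+ p) (ℤ.+ i) (t p i)) ⟩
    ℤ.+ suc p ℤ.* t p i ℤ.+ ℤ.+ i ℤ.* t p i ℤ.- ℤ.+ suc p ℤ.* t (suc p) i
  ≡⟨ cong (λ a → ℤ.+ suc p ℤ.* t p i ℤ.+ a ℤ.- ℤ.+ suc p ℤ.* t (suc p) i) (right i) ⟨
    ℤ.+ suc p ℤ.* t p i ℤ.+ ℤ.+ suc p ℤ.* shift (t (suc p)) i ℤ.- ℤ.+ suc p ℤ.* t (suc p) i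
  ≡⟨ expand (ℤ.+ suc p) (t p i) (shift (t (suc p)) i) (t (suc p) i) ⟨
    ℤ.+ suc p ℤ.* (t p i ℤ.+ shift (t (suc p)) i ℤ.- t (suc p) i) ∎
  where
  open ≡-Reasoning
  t : ℕ → ℕ → ℤ
  t = taylor m
  expand : ∀ c x y z → c ℤ.* (x ℤ.+ y ℤ.- z) ≡ c ℤ.* x ℤ.+ c ℤ.* y ℤ.- c ℤ.* z
  expand = solve-∀
  swap : ∀ p i c → p ℤ.* c ℤ.+ (1ℤ ℤ.+ i) ℤ.* c ≡ (1ℤ ℤ.+ p) ℤ.* c ℤ.+ i ℤ.* c
  swap = solve-∀
  left : ∀ p → ℤ.+ suc i ℤ.* shift (λ p → t p (suc i)) p ≡ ℤ.+ p ℤ.* t p i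
  left zero    = ℤₚ.*-zeroʳ (ℤ.+ suc i)
  left (suc p) = taylor-∂ m p i
  right : ∀ i → ℤ.+ suc p ℤ.* shift (t (suc p)) i ≡ ℤ.+ i ℤ.* t p i
  right zero    = ℤₚ.*-zeroʳ (ℤ.+ suc p)
  right (suc i) = sym (taylor-∂ m p i)

-- Separable polynomials

sumTo-cong : ∀ n {f g : ℕ → ℤ} → f ≗ g → sumTo n f ≡ sumTo n g
sumTo-cong zero    f≗g = f≗g 0
sumTo-cong (suc n) f≗g = cong₂ ℤ._+_ (sumTo-cong n f≗g) (f≗g (suc n))

sumTo-*ˡ : ∀ n c f → sumTo n (λ a → c ℤ.* f a) ≡ c ℤ.* sumTo n f
sumTo-*ˡ zero    c f = refl
sumTo-*ˡ (suc n) c f = trans (cong (ℤ._+ c ℤ.* f (suc n)) (sumTo-*ˡ n c f))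
                         (sym (ℤₚ.*-distribˡ-+ c (sumTo n f) (f (suc n))))

sumTo-*ʳ : ∀ n c f → sumTo n (λ a → f a ℤ.* c) ≡ sumTo n f ℤ.* c
sumTo-*ʳ n c f = trans (sumTo-cong n (λ a → ℤₚ.*-comm (f a) c))
                   (trans (sumTo-*ˡ n c f) (ℤₚ.*-comm c (sumTo n f)))

sumTo-head : ∀ n f → sumTo (suc n) f ≡ f 0 ℤ.+ sumTo n (λ a → f (suc a))
sumTo-head zero    f = refl
sumTo-head (suc n) f = trans (cong (ℤ._+ f (suc (suc n))) (sumTo-head n f)) (ℤₚ.+-assoc (f 0) _ _)

sumTo-zero : ∀ n {f : ℕ → ℤ} → (∀ a → f a ≡ 0ℤ) → sumTo n f ≡ 0ℤ
sumTo-zero zero    f≡0 = f≡0 0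
sumTo-zero (suc n) f≡0 = cong₂ ℤ._+_ (sumTo-zero n f≡0) (f≡0 (suc n))

conv : (ℕ → ℤ) → (ℕ → ℤ) → ℕ → ℤ
conv f g n = sumTo n λ a → f a ℤ.* g (n ∸ a)

conv-head : ∀ f g n → conv f g (suc n) ≡ f 0 ℤ.* g (suc n) ℤ.+ conv (λ a → f (suc a)) g n
conv-head f g n = sumTo-head n λ a → f a ℤ.* g (suc n ∸ a)

conv-0 : ∀ f g → (∀ a → f a ≡ 0ℤ) → conv f g ≗ λ _ → 0ℤ
conv-0 f g f≡0 n = sumTo-zero n λ a → cong (ℤ._* g (n ∸ a)) (f≡0 a)

conv-constant : ∀ f g → (∀ a → f (suc a) ≡ 0ℤ) → conv f g ≗ λ n → f 0 ℤ.* g n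
conv-constant f g f≡0 zero    = refl
conv-constant f g f≡0 (suc n) =
  trans (conv-head f g n) (trans (cong (λ s → f 0 ℤ.* g (suc n) ℤ.+ s) (conv-0 _ g f≡0 n)) (ℤₚ.+-identityʳ _))

conv-linear : ∀ f g → (∀ a → f (suc (suc a)) ≡ 0ℤ) → conv f g ≗ λ n → f 0 ℤ.* g n ℤ.+ f 1 ℤ.* shift g n
conv-linear f g f≡0 zero    =
  sym (trans (cong (λ s → f 0 ℤ.* g 0 ℤ.+ s) (ℤₚ.*-zeroʳ (f 1))) (ℤₚ.+-identityʳ _))
conv-linear f g f≡0 (suc n) = trans (conv-head f g n)
  (cong (λ s → f 0 ℤ.* g (suc n) ℤ.+ s) (conv-constant (λ a → f (suc a)) g f≡0 n))

conv-identityˡ : ∀ g → conv (δ 0) g ≗ g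
conv-identityˡ g n = trans (conv-constant (δ 0) g (λ _ → refl) n) (ℤₚ.*-identityˡ (g n))

conv-identityʳ : ∀ f → conv f (δ 0) ≗ f
conv-identityʳ f zero    = ℤₚ.*-identityʳ (f 0)
conv-identityʳ f (suc n) = begin
  conv f (δ 0) (suc n)                           ≡⟨ conv-head f (δ 0) n ⟩
  f 0 ℤ.* 0ℤ ℤ.+ conv (λ a → f (suc a)) (δ 0) n
    ≡⟨ cong₂ ℤ._+_ (ℤₚ.*-zeroʳ (f 0)) (conv-identityʳ (λ a → f (suc a)) n) ⟩
  0ℤ ℤ.+ f (suc n)                                 ≡⟨ ℤₚ.+-identityˡ _ ⟩
  f (suc n)                                      ∎
  where open ≡-Reasoning

conv-δ : ∀ m → conv (δ 1) (δ m) ≗ δ (suc m)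
conv-δ m n = trans (conv-linear (δ 1) (δ m) (λ _ → refl) n) (trans (ℤₚ.+-identityˡ _)
  (trans (ℤₚ.*-identityˡ _) (sym (δ-suc m n))))

x-1 : ℕ → ℤ
x-1 a = δ 1 a ℤ.- δ 0 a

conv-taylor : ∀ m → conv x-1 (taylor m 0) ≗ taylor (suc m) 0
conv-taylor m n = trans (conv-linear x-1 (taylor m 0) (λ _ → refl) n)
  (lemma (taylor m 0 n) (shift (taylor m 0) n))
  where
  lemma : ∀ a b → - 1ℤ ℤ.* a ℤ.+ 1ℤ ℤ.* b ≡ 0ℤ ℤ.+ b ℤ.- a
  lemma = solve-∀

-- A product f(x)g(y)h(z). All factors on both sides of the theorem have this form, so the triple
-- convolution in `_*ₚ_` splits into three one-variable ones.
sep : (f g h : ℕ → ℤ) → Poly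
sep f g h i j k = f i ℤ.* (g j ℤ.* h k)

sep-cong : ∀ {f f′ g g′ h h′ : ℕ → ℤ} → f ≗ f′ → g ≗ g′ → h ≗ h′ → sep f g h ≈ₚ sep f′ g′ h′
sep-cong f≗ g≗ h≗ i j k = cong₂ ℤ._*_ (f≗ i) (cong₂ ℤ._*_ (g≗ j) (h≗ k))

*ₚ-cong : ∀ {f f′ g g′} → f ≈ₚ f′ → g ≈ₚ g′ → (f *ₚ g) ≈ₚ (f′ *ₚ g′)
*ₚ-cong f≈ g≈ i j k = sumTo-cong i λ a → sumTo-cong j λ b → sumTo-cong k λ c →
  cong₂ ℤ._*_ (f≈ a b c) (g≈ (i ∸ a) (j ∸ b) (k ∸ c))

sep-* : ∀ f g h f′ g′ h′ → (sep f g h *ₚ sep f′ g′ h′) ≈ₚ sep (conv f f′) (conv g g′) (conv h h′)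
sep-* f g h f′ g′ h′ i j k = begin
    (sumTo i λ a → sumTo j λ b → sumTo k λ c → sep f g h a b c ℤ.* sep f′ g′ h′ (i ∸ a) (j ∸ b) (k ∸ c))
  ≡⟨ (sumTo-cong i λ a → sumTo-cong j λ b → sumTo-cong k λ c →
       regroup (f a) (g b) (h c) (f′ (i ∸ a)) (g′ (j ∸ b)) (h′ (k ∸ c))) ⟩
    (sumTo i λ a → sumTo j λ b → sumTo k λ c → F a ℤ.* (G b ℤ.* H c))
  ≡⟨ (sumTo-cong i λ a → sumTo-cong j λ b →
       trans (sumTo-*ˡ k (F a) (λ c → G b ℤ.* H c)) (cong (F a ℤ.*_) (sumTo-*ˡ k (G b) H))) ⟩
    (sumTo i λ a → sumTo j λ b → F a ℤ.* (G b ℤ.* conv h h′ k))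
  ≡⟨ (sumTo-cong i λ a → trans (sumTo-*ˡ j (F a) (λ b → G b ℤ.* conv h h′ k))
       (cong (F a ℤ.*_) (sumTo-*ʳ j (conv h h′ k) G))) ⟩
    (sumTo i λ a → F a ℤ.* (conv g g′ j ℤ.* conv h h′ k))
  ≡⟨ sumTo-*ʳ i (conv g g′ j ℤ.* conv h h′ k) F ⟩
    conv f f′ i ℤ.* (conv g g′ j ℤ.* conv h h′ k) ∎
  where
  open ≡-Reasoning
  F G H : ℕ → ℤ
  F a = f a ℤ.* f′ (i ∸ a)
  G b = g b ℤ.* g′ (j ∸ b)
  H c = h c ℤ.* h′ (k ∸ c)
  regroup : ∀ a b c a′ b′ c′ → a ℤ.* (b ℤ.* c) ℤ.* (a′ ℤ.* (b′ ℤ.* c′)) ≡ a ℤ.* a′ ℤ.* (b ℤ.* b′ ℤ.* (c ℤ.* c′))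
  regroup = solve-∀

δ-≡ᵇ : ∀ a i → δ a i ≡ (if i ≡ᵇ a then 1ℤ else 0ℤ)
δ-≡ᵇ zero    zero    = refl
δ-≡ᵇ zero    (suc i) = refl
δ-≡ᵇ (suc a) zero    = refl
δ-≡ᵇ (suc a) (suc i) = δ-≡ᵇ a i

monoₚ-sep : ∀ a b c → monoₚ a b c 1ℤ ≈ₚ sep (δ a) (δ b) (δ c)
monoₚ-sep a b c i j k rewrite δ-≡ᵇ a i | δ-≡ᵇ b j | δ-≡ᵇ c k with i ≡ᵇ a | j ≡ᵇ b | k ≡ᵇ c
... | false | _     | _     = refl
... | true  | false | _     = refl
... | true  | true  | false = refl
... | true  | true  | true  = refl

≈ₚ-trans : ∀ {f g h} → f ≈ₚ g → g ≈ₚ h → f ≈ₚ h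
≈ₚ-trans f≈g g≈h i j k = trans (f≈g i j k) (g≈h i j k)

X^-sep : ∀ m → (X ^ₚ m) ≈ₚ sep (δ m) (δ 0) (δ 0)
X^-sep zero    = monoₚ-sep 0 0 0
X^-sep (suc m) = ≈ₚ-trans (*ₚ-cong (monoₚ-sep 1 0 0) (X^-sep m))
  (≈ₚ-trans (sep-* (δ 1) (δ 0) (δ 0) (δ m) (δ 0) (δ 0))
    (sep-cong (conv-δ m) (conv-identityˡ (δ 0)) (conv-identityˡ (δ 0))))

Y^-sep : ∀ m → (Y ^ₚ m) ≈ₚ sep (δ 0) (δ m) (δ 0)
Y^-sep zero    = monoₚ-sep 0 0 0
Y^-sep (suc m) = ≈ₚ-trans (*ₚ-cong (monoₚ-sep 0 1 0) (Y^-sep m))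
  (≈ₚ-trans (sep-* (δ 0) (δ 1) (δ 0) (δ 0) (δ m) (δ 0))
    (sep-cong (conv-identityˡ (δ 0)) (conv-δ m) (conv-identityˡ (δ 0))))

Z^-sep : ∀ m → (Z ^ₚ m) ≈ₚ sep (δ 0) (δ 0) (δ m)
Z^-sep zero    = monoₚ-sep 0 0 0
Z^-sep (suc m) = ≈ₚ-trans (*ₚ-cong (monoₚ-sep 0 0 1) (Z^-sep m))
  (≈ₚ-trans (sep-* (δ 0) (δ 0) (δ 1) (δ 0) (δ 0) (δ m))
    (sep-cong (conv-identityˡ (δ 0)) (conv-identityˡ (δ 0)) (conv-δ m)))

taylor-0 : δ 0 ≗ taylor 0 0
taylor-0 i = sym (ℤₚ.*-identityˡ (δ 0 i))

X-1-sep : (X -ₚ 1ₚ) ≈ₚ sep x-1 (δ 0) (δ 0)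
X-1-sep i j k = trans (cong₂ ℤ._-_ (monoₚ-sep 1 0 0 i j k) (monoₚ-sep 0 0 0 i j k))
  (lemma (δ 1 i) (δ 0 i) (δ 0 j ℤ.* δ 0 k))
  where
  lemma : ∀ a b c → a ℤ.* c ℤ.- b ℤ.* c ≡ (a ℤ.- b) ℤ.* c
  lemma = solve-∀

Y-1-sep : (Y -ₚ 1ₚ) ≈ₚ sep (δ 0) x-1 (δ 0)
Y-1-sep i j k = trans (cong₂ ℤ._-_ (monoₚ-sep 0 1 0 i j k) (monoₚ-sep 0 0 0 i j k))
  (lemma (δ 0 i) (δ 1 j) (δ 0 j) (δ 0 k))
  where
  lemma : ∀ a b c d → a ℤ.* (b ℤ.* d) ℤ.- a ℤ.* (c ℤ.* d) ≡ a ℤ.* ((b ℤ.- c) ℤ.* d)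
  lemma = solve-∀

[X-1]^-sep : ∀ m → ((X -ₚ 1ₚ) ^ₚ m) ≈ₚ sep (taylor m 0) (δ 0) (δ 0)
[X-1]^-sep zero    = ≈ₚ-trans (monoₚ-sep 0 0 0) (sep-cong {g = δ 0} {h = δ 0} taylor-0 (λ _ → refl) (λ _ → refl))
[X-1]^-sep (suc m) = ≈ₚ-trans (*ₚ-cong X-1-sep ([X-1]^-sep m))
  (≈ₚ-trans (sep-* x-1 (δ 0) (δ 0) (taylor m 0) (δ 0) (δ 0))
    (sep-cong (conv-taylor m) (conv-identityˡ (δ 0)) (conv-identityˡ (δ 0))))

[Y-1]^-sep : ∀ m → ((Y -ₚ 1ₚ) ^ₚ m) ≈ₚ sep (δ 0) (taylor m 0) (δ 0)
[Y-1]^-sep zero    = ≈ₚ-trans (monoₚ-sep 0 0 0) (sep-cong {f = δ 0} {h = δ 0} (λ _ → refl) taylor-0 (λ _ → refl))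
[Y-1]^-sep (suc m) = ≈ₚ-trans (*ₚ-cong Y-1-sep ([Y-1]^-sep m))
  (≈ₚ-trans (sep-* (δ 0) x-1 (δ 0) (δ 0) (taylor m 0) (δ 0))
    (sep-cong (conv-identityˡ (δ 0)) (conv-taylor m) (conv-identityˡ (δ 0))))

sep-product : ∀ {f g h P Q R} → P ≈ₚ sep f (δ 0) (δ 0) → Q ≈ₚ sep (δ 0) g (δ 0) → R ≈ₚ sep (δ 0) (δ 0) h →
              (P *ₚ (Q *ₚ R)) ≈ₚ sep f g h
sep-product {f} {g} {h} P≈ Q≈ R≈ = ≈ₚ-trans (*ₚ-cong P≈
    (≈ₚ-trans (*ₚ-cong Q≈ R≈) (≈ₚ-trans (sep-* (δ 0) g (δ 0) (δ 0) (δ 0) h)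
      (sep-cong (conv-identityˡ (δ 0)) (conv-identityʳ g) (conv-identityˡ h)))))
  (≈ₚ-trans (sep-* f (δ 0) (δ 0) (δ 0) g h)
    (sep-cong (conv-identityʳ f) (conv-identityˡ g) (conv-identityˡ h)))

-- Sums over subsets

∑ : ∀ n → (Subset n → ℤ) → ℤ
∑ zero    h = h []
∑ (suc n) h = ∑ n (λ A → h (false ∷ A)) ℤ.+ ∑ n (λ A → h (true ∷ A))

∑-cong : ∀ n {g h : Subset n → ℤ} → g ≗ h → ∑ n g ≡ ∑ n h
∑-cong zero    g≗h = g≗h []
∑-cong (suc n) g≗h = cong₂ ℤ._+_ (∑-cong n (g≗h ∘ (false ∷_))) (∑-cong n (g≗h ∘ (true ∷_)))

+-medial : ∀ a b c d → (a ℤ.+ b) ℤ.+ (c ℤ.+ d) ≡ (a ℤ.+ c) ℤ.+ (b ℤ.+ d)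
+-medial = solve-∀

∑-+ : ∀ n (g h : Subset n → ℤ) → ∑ n g ℤ.+ ∑ n h ≡ ∑ n (λ A → g A ℤ.+ h A)
∑-+ zero    g h = refl
∑-+ (suc n) g h = trans (+-medial (∑ n (g ∘ (false ∷_))) _ (∑ n (h ∘ (false ∷_))) _)
  (cong₂ ℤ._+_ (∑-+ n _ _) (∑-+ n _ _))

∑-*ˡ : ∀ n c (h : Subset n → ℤ) → c ℤ.* ∑ n h ≡ ∑ n (λ A → c ℤ.* h A)
∑-*ˡ zero    c h = refl
∑-*ˡ (suc n) c h = trans (ℤₚ.*-distribˡ-+ c (∑ n (h ∘ (false ∷_))) _) (cong₂ ℤ._+_ (∑-*ˡ n c _) (∑-*ˡ n c _))

∑-0 : ∀ n → ∑ n (λ _ → 0ℤ) ≡ 0ℤ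
∑-0 zero    = refl
∑-0 (suc n) = cong₂ ℤ._+_ (∑-0 n) (∑-0 n)

∑-shift : ∀ n (h : Subset n → ℕ → ℤ) m → ∑ n (λ A → shift (h A) m) ≡ shift (λ m → ∑ n (λ A → h A m)) m
∑-shift n h zero    = ∑-0 n
∑-shift n h (suc m) = refl

-- `∑` branches on the smallest element, at the head of the vector; the recursion needs the branch
-- on the greatest, at its end.
∑-∷ʳ : ∀ n (h : Subset (suc n) → ℤ) → ∑ (suc n) h ≡ ∑ n (λ A → h (A ∷ʳ false)) ℤ.+ ∑ n (λ A → h (A ∷ʳ true))
∑-∷ʳ zero    h = refl
∑-∷ʳ (suc n) h = trans (cong₂ ℤ._+_ (∑-∷ʳ n (h ∘ (false ∷_))) (∑-∷ʳ n (h ∘ (true ∷_))))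
  (+-medial (∑ n (λ A → h (false ∷ (A ∷ʳ false)))) _ (∑ n (λ A → h (true ∷ (A ∷ʳ false)))) _)

-- Rank functions

-- The axioms only involve differences of ranks, so that contraction is mere composition with true ∷_ or
-- _∷ʳ true, without subtracting the rank of the contracted element.
record IsRank {n} (ρ : Subset n → ℕ) : Set where
  field
    mono   : ∀ {A B} → A ⊆ B → ρ A ≤ ρ B
    unit   : ∀ {A B} → A ⊆ B → ρ B + ∣ A ∣ ≤ ρ A + ∣ B ∣
    submod : ∀ A B → ρ (A ∪ B) + ρ (A ∩ B) ≤ ρ A + ρ B

  -- Submodularity with the union and the intersection known only up to inclusion; monotonicity
  -- absorbs the slack.
  diminish : ∀ {S S′ T T′} → T′ ⊆ S′ ∪ T → S ⊆ S′ ∩ T → ρ T′ + ρ S ≤ ρ S′ + ρ T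
  diminish T′⊆ S⊆ = ℕₚ.≤-trans (ℕₚ.+-mono-≤ (mono T′⊆) (mono S⊆)) (submod _ _)

open IsRank

𝟙 : Bool → ℕ
𝟙 b = if b then 1 else 0

private variable
  n : ℕ

⊆-∷ʳ : ∀ {A B : Subset n} b → A ⊆ B → A ∷ʳ b ⊆ B ∷ʳ b
⊆-∷ʳ {A = []}    {[]}    b A⊆B = λ p → p
⊆-∷ʳ {A = x ∷ A} {y ∷ B} b A⊆B {zero}  here with here ← A⊆B here = here
⊆-∷ʳ {A = x ∷ A} {y ∷ B} b A⊆B {suc e} (there p) = there (⊆-∷ʳ b (drop-∷-⊆ A⊆B) p)

⊆-∷ʳ-true : ∀ (A : Subset n) → A ∷ʳ false ⊆ A ∷ʳ true
⊆-∷ʳ-true []      = out⊆ (λ p → p)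
⊆-∷ʳ-true (x ∷ A) = s⊆s (⊆-∷ʳ-true A)

zipWith-∷ʳ : ∀ (f : Bool → Bool → Bool) (A B : Subset n) a b → zipWith f (A ∷ʳ a) (B ∷ʳ b) ≡ zipWith f A B ∷ʳ f a b
zipWith-∷ʳ f []      []      a b = refl
zipWith-∷ʳ f (x ∷ A) (y ∷ B) a b = cong (f x y ∷_) (zipWith-∷ʳ f A B a b)

⊤-∷ʳ : ∀ n → ⊤ {suc n} ≡ ⊤ {n} ∷ʳ true
⊤-∷ʳ zero    = refl
⊤-∷ʳ (suc n) = cong (true ∷_) (⊤-∷ʳ n)

⊥-∷ʳ : ∀ n → ⊥ {suc n} ≡ ⊥ {n} ∷ʳ false
⊥-∷ʳ zero    = refl
⊥-∷ʳ (suc n) = cong (false ∷_) (⊥-∷ʳ n)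

∣∷∣ : ∀ b (A : Subset n) → ∣ b ∷ A ∣ ≡ 𝟙 b + ∣ A ∣
∣∷∣ false A = refl
∣∷∣ true  A = refl

∣∷ʳ∣ : ∀ b (A : Subset n) → ∣ A ∷ʳ b ∣ ≡ 𝟙 b + ∣ A ∣
∣∷ʳ∣ b []          = ∣∷∣ b []
∣∷ʳ∣ b (false ∷ A) = ∣∷ʳ∣ b A
∣∷ʳ∣ b (true ∷ A)  = trans (cong suc (∣∷ʳ∣ b A)) (sym (ℕₚ.+-suc (𝟙 b) ∣ A ∣))

+-rotate : ∀ a b c → a + (b + c) ≡ b + (a + c)
+-rotate = ℕ-Solver.solve-∀

cancel-size : ∀ c {x y a b} → x + (c + a) ≤ y + (c + b) → x + a ≤ y + b
cancel-size c {x} {y} {a} {b} p = ℕₚ.+-cancelˡ-≤ c _ _ (subst₂ _≤_ (+-rotate x c a) (+-rotate y c b) p)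

-- Minors at either end of the vector arise by inserting a fixed bit, a map that respects inclusion,
-- `∪` and `∩` and adds a constant to sizes; that constant cancels in `unit`.
∘-isRank : ∀ {m} {ρ : Subset m → ℕ} (f : Subset n → Subset m) c → IsRank ρ →
           (∀ {A B} → A ⊆ B → f A ⊆ f B) → (∀ A → ∣ f A ∣ ≡ c + ∣ A ∣) →
           (∀ A B → f A ∪ f B ≡ f (A ∪ B)) → (∀ A B → f A ∩ f B ≡ f (A ∩ B)) → IsRank (ρ ∘ f)
∘-isRank {ρ = ρ} f c R f-mono f-size f-∪ f-∩ = record
  { mono   = λ A⊆B → mono R (f-mono A⊆B)
  ; unit   = λ {A} {B} A⊆B → cancel-size c {ρ (f B)} {ρ (f A)}
      (subst₂ (λ x y → ρ (f B) + x ≤ ρ (f A) + y) (f-size A) (f-size B) (unit R (f-mono A⊆B)))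
  ; submod = λ A B → subst₂ (λ X Y → ρ X + ρ Y ≤ ρ (f A) + ρ (f B)) (f-∪ A B) (f-∩ A B) (submod R (f A) (f B))
  }

∷-isRank : ∀ {ρ : Subset (suc n) → ℕ} b → IsRank ρ → IsRank (ρ ∘ (b ∷_))
∷-isRank b R = ∘-isRank (b ∷_) (𝟙 b) R s⊆s (∣∷∣ b)
  (λ A B → cong (_∷ A ∪ B) (∨-idem b)) (λ A B → cong (_∷ A ∩ B) (∧-idem b))

∷ʳ-isRank : ∀ {ρ : Subset (suc n) → ℕ} b → IsRank ρ → IsRank (ρ ∘ (_∷ʳ b))
∷ʳ-isRank b R = ∘-isRank (_∷ʳ b) (𝟙 b) R (⊆-∷ʳ b) (∣∷ʳ∣ b)
  (λ A B → trans (zipWith-∷ʳ _∨_ A B b b) (cong ((A ∪ B) ∷ʳ_) (∨-idem b)))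
  (λ A B → trans (zipWith-∷ʳ _∧_ A B b b) (cong ((A ∩ B) ∷ʳ_) (∧-idem b)))

-- Marginal rank of the greatest element, loops and coloops

del con : (Subset (suc n) → ℕ) → Subset n → ℕ
del ρ A = ρ (A ∷ʳ false)
con ρ A = ρ (A ∷ʳ true)

module _ {ρ : Subset (suc n) → ℕ} (R : IsRank ρ) where

  del-or-suc : ∀ A → con ρ A ≡ del ρ A ⊎ con ρ A ≡ suc (del ρ A)
  del-or-suc A with ℕₚ.m≤n⇒m<n∨m≡n (mono R (⊆-∷ʳ-true A))
  ... | inj₂ eq = inj₁ (sym eq)
  ... | inj₁ lt = inj₂ (ℕₚ.≤-antisym (ℕₚ.+-cancelʳ-≤ ∣ A ∣ _ _ con≤) lt)
    where
    con≤ : con ρ A + ∣ A ∣ ≤ suc (del ρ A) + ∣ A ∣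
    con≤ = subst₂ _≤_ (cong (con ρ A +_) (∣∷ʳ∣ false A))
      (trans (cong (del ρ A +_) (∣∷ʳ∣ true A)) (ℕₚ.+-suc (del ρ A) ∣ A ∣)) (unit R (⊆-∷ʳ-true A))

  -- The gain in rank from the greatest element is largest at `⊥` and smallest at `⊤`; a single
  -- comparison there decides whether it is a loop or a coloop.
  con-diminish : ∀ {A B} → A ⊆ B → con ρ B + del ρ A ≤ con ρ A + del ρ B
  con-diminish {A} {B} A⊆B = diminish R
    (subst (B ∷ʳ true ⊆_) (sym (zipWith-∷ʳ _∨_ A B true false)) (⊆-∷ʳ true (q⊆p∪q A B)))
    (subst (A ∷ʳ false ⊆_) (sym (zipWith-∷ʳ _∧_ A B true false)) (⊆-∷ʳ false (λ e∈A → x∈p∩q⁺ (e∈A , A⊆B e∈A))))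

-- Circuit-free form of a perspective: `quotient` is monotonicity of the difference of `ρ` and `ρ′`,
-- with the subtractions moved across. It passes to minors by mere composition.
record IsPerspective (ρ ρ′ : Subset n → ℕ) : Set where
  field
    isRank   : IsRank ρ
    isRank′  : IsRank ρ′
    quotient : ∀ {A B} → A ⊆ B → ρ′ B + ρ A ≤ ρ B + ρ′ A

open IsPerspective

∷ʳ-isPerspective : ∀ {ρ ρ′ : Subset (suc n) → ℕ} b → IsPerspective ρ ρ′ → IsPerspective (ρ ∘ (_∷ʳ b)) (ρ′ ∘ (_∷ʳ b))
∷ʳ-isPerspective b P = record
  { isRank   = ∷ʳ-isRank b (isRank P)
  ; isRank′  = ∷ʳ-isRank b (isRank′ P)
  ; quotient = λ A⊆B → quotient P (⊆-∷ʳ b A⊆B)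
  }

module _ {ρ ρ′ : Subset (suc n) → ℕ} (P : IsPerspective ρ ρ′) where

  private
    clash : ∀ a b {c d} → c ≡ suc a → d ≡ b → ¬ c + b ≤ d + a
    clash a b refl refl p = ℕₚ.<-irrefl refl (subst (suc a + b ≤_) (ℕₚ.+-comm b a) p)

  -- The gain is smallest at `⊤`, so a gain of one there forces it everywhere.
  coloop′ : con ρ′ ⊤ ≡ suc (del ρ′ ⊤) → ∀ A → con ρ′ A ≡ suc (del ρ′ A)
  coloop′ eq A with del-or-suc (isRank′ P) A
  ... | inj₂ s = s
  ... | inj₁ e = ⊥-elim (clash (del ρ′ ⊤) (del ρ′ A) eq e (con-diminish (isRank′ P) ⊆⊤))

  -- By `quotient` the gain in `ρ′` never exceeds that in `ρ`, so a gain of one passes from `ρ′` to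
  -- `ρ`; likewise `loop′` passes a gain of zero from `ρ` to `ρ′`.
  coloop : con ρ′ ⊤ ≡ suc (del ρ′ ⊤) → ∀ A → con ρ A ≡ suc (del ρ A)
  coloop eq A with del-or-suc (isRank P) A
  ... | inj₂ s = s
  ... | inj₁ e = ⊥-elim (clash (del ρ′ A) (del ρ A) (coloop′ eq A) e (quotient P (⊆-∷ʳ-true A)))

  loop : con ρ ⊥ ≡ del ρ ⊥ → ∀ A → con ρ A ≡ del ρ A
  loop eq A with del-or-suc (isRank P) A
  ... | inj₁ e = e
  ... | inj₂ s = ⊥-elim (clash (del ρ A) (del ρ ⊥) s eq (con-diminish (isRank P) ⊥⊆))

  loop′ : con ρ ⊥ ≡ del ρ ⊥ → ∀ A → con ρ′ A ≡ del ρ′ A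
  loop′ eq A with del-or-suc (isRank′ P) A
  ... | inj₁ e = e
  ... | inj₂ s = ⊥-elim (clash (del ρ′ A) (del ρ A) s (loop eq A) (quotient P (⊆-∷ʳ-true A)))

-- Deletion and contraction of the greatest element

-- `ρ ⊥` may be positive, since contraction keeps the rank of the contracted elements; `nullity`
-- compensates for it.
corank nullity : (Subset n → ℕ) → Subset n → ℕ
corank  ρ A = ρ ⊤ ∸ ρ A
nullity ρ A = (∣ A ∣ + ρ ⊥) ∸ ρ A

codrop : (Subset n → ℕ) → (Subset n → ℕ) → Subset n → ℕ
codrop ρ ρ′ A = (ρ ⊤ + ρ′ A) ∸ (ρ′ ⊤ + ρ A)

-- e is externally active iff it lies in the closure of {a ∈ A ∣ a > e}: the elements below e are deleted.
-- Dually for internal activity, where they are contracted.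
ext int : (Subset n → ℕ) → Subset n → ℕ
ext ρ []          = 0
ext ρ (false ∷ A) = 𝟙 (ρ (true ∷ A) ≡ᵇ ρ (false ∷ A)) + ext (ρ ∘ (false ∷_)) A
ext ρ (true ∷ A)  = ext (ρ ∘ (false ∷_)) A
int ρ []          = 0
int ρ (false ∷ A) = int (ρ ∘ (true ∷_)) A
int ρ (true ∷ A)  = 𝟙 (ρ (true ∷ A) ≡ᵇ suc (ρ (false ∷ A))) + int (ρ ∘ (true ∷_)) A

-- When the test reaches the last element, all earlier ones have been deleted, so it compares ranks
-- over `⊥` and detects a loop. The other tests only see sets omitting that element.
ext-del : ∀ (ρ : Subset (suc n) → ℕ) A → ext ρ (A ∷ʳ false) ≡ 𝟙 (con ρ ⊥ ≡ᵇ del ρ ⊥) + ext (del ρ) A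
ext-del ρ []          = refl
ext-del ρ (false ∷ A) = trans (cong (𝟙 (ρ (true ∷ (A ∷ʳ false)) ≡ᵇ ρ (false ∷ (A ∷ʳ false))) +_) (ext-del (ρ ∘ (false ∷_)) A))
  (+-rotate (𝟙 (ρ (true ∷ (A ∷ʳ false)) ≡ᵇ ρ (false ∷ (A ∷ʳ false)))) (𝟙 (con ρ ⊥ ≡ᵇ del ρ ⊥)) _)
ext-del ρ (true ∷ A)  = ext-del (ρ ∘ (false ∷_)) A

ext-con : ∀ (ρ : Subset (suc n) → ℕ) A → ext ρ (A ∷ʳ true) ≡ ext (con ρ) A
ext-con ρ []          = refl
ext-con ρ (false ∷ A) = cong (𝟙 (ρ (true ∷ (A ∷ʳ true)) ≡ᵇ ρ (false ∷ (A ∷ʳ true))) +_) (ext-con (ρ ∘ (false ∷_)) A)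
ext-con ρ (true ∷ A)  = ext-con (ρ ∘ (false ∷_)) A

int-del : ∀ (ρ : Subset (suc n) → ℕ) A → int ρ (A ∷ʳ false) ≡ int (del ρ) A
int-del ρ []          = refl
int-del ρ (false ∷ A) = int-del (ρ ∘ (true ∷_)) A
int-del ρ (true ∷ A)  = cong (𝟙 (ρ (true ∷ (A ∷ʳ false)) ≡ᵇ suc (ρ (false ∷ (A ∷ʳ false)))) +_) (int-del (ρ ∘ (true ∷_)) A)

-- Dually, all earlier elements have been contracted by then, so the last test is made over `⊤` and
-- detects a coloop.
int-con : ∀ (ρ : Subset (suc n) → ℕ) A → int ρ (A ∷ʳ true) ≡ 𝟙 (con ρ ⊤ ≡ᵇ suc (del ρ ⊤)) + int (con ρ) A
int-con ρ []          = refl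
int-con ρ (false ∷ A) = int-con (ρ ∘ (true ∷_)) A
int-con ρ (true ∷ A)  = trans (cong (𝟙 (ρ (true ∷ (A ∷ʳ true)) ≡ᵇ suc (ρ (false ∷ (A ∷ʳ true)))) +_) (int-con (ρ ∘ (true ∷_)) A))
  (+-rotate (𝟙 (ρ (true ∷ (A ∷ʳ true)) ≡ᵇ suc (ρ (false ∷ (A ∷ʳ true))))) (𝟙 (con ρ ⊤ ≡ᵇ suc (del ρ ⊤))) _)

≡ᵇ-+ : ∀ c a b → (c + a ≡ᵇ c + b) ≡ (a ≡ᵇ b)
≡ᵇ-+ zero    a b = refl
≡ᵇ-+ (suc c) a b = ≡ᵇ-+ c a b

-- Together with the shifts of the other statistics, this makes deletion and contraction
-- interchangeable at a loop or coloop, where their ranks differ by a constant.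
ext-shift : ∀ c {σ ρ : Subset n → ℕ} → (∀ A → σ A ≡ c + ρ A) → ∀ A → ext σ A ≡ ext ρ A
ext-shift c eq []          = refl
ext-shift c {σ} {ρ} eq (false ∷ A) = cong₂ (λ b m → 𝟙 b + m)
  (trans (cong₂ _≡ᵇ_ (eq (true ∷ A)) (eq (false ∷ A))) (≡ᵇ-+ c _ _)) (ext-shift c (eq ∘ (false ∷_)) A)
ext-shift c eq (true ∷ A)  = ext-shift c (eq ∘ (false ∷_)) A

int-shift : ∀ c {σ ρ : Subset n → ℕ} → (∀ A → σ A ≡ c + ρ A) → ∀ A → int σ A ≡ int ρ A
int-shift c eq []          = refl
int-shift c eq (false ∷ A) = int-shift c (eq ∘ (true ∷_)) A
int-shift c {σ} {ρ} eq (true ∷ A)  = cong₂ (λ b m → 𝟙 b + m)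
  (trans (cong₂ _≡ᵇ_ (eq (true ∷ A)) (trans (cong suc (eq (false ∷ A))) (sym (ℕₚ.+-suc c _)))) (≡ᵇ-+ c _ _))
  (int-shift c (eq ∘ (true ∷_)) A)

corank-shift : ∀ c {σ ρ : Subset n → ℕ} → (∀ A → σ A ≡ c + ρ A) → ∀ A → corank σ A ≡ corank ρ A
corank-shift c {σ} {ρ} eq A = trans (cong₂ _∸_ (eq ⊤) (eq A)) (ℕₚ.[m+n]∸[m+o]≡n∸o c (ρ ⊤) (ρ A))

nullity-shift : ∀ c {σ ρ : Subset n → ℕ} → (∀ A → σ A ≡ c + ρ A) → ∀ A → nullity σ A ≡ nullity ρ A
nullity-shift c {σ} {ρ} eq A = trans
  (cong₂ _∸_ (trans (cong (∣ A ∣ +_) (eq ⊥)) (+-rotate ∣ A ∣ c (ρ ⊥))) (eq A)) (ℕₚ.[m+n]∸[m+o]≡n∸o c (∣ A ∣ + ρ ⊥) (ρ A))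

+-interchange : ∀ a b c d → (a + b) + (c + d) ≡ (a + c) + (b + d)
+-interchange = ℕ-Solver.solve-∀

codrop-shift : ∀ c {σ ρ σ′ ρ′ : Subset n → ℕ} → (∀ A → σ A ≡ c + ρ A) → (∀ A → σ′ A ≡ c + ρ′ A) →
               ∀ A → codrop σ σ′ A ≡ codrop ρ ρ′ A
codrop-shift c {σ} {ρ} {σ′} {ρ′} eq eq′ A = trans (cong₂ _∸_
  (trans (cong₂ _+_ (eq ⊤) (eq′ A)) (+-interchange c (ρ ⊤) c (ρ′ A)))
  (trans (cong₂ _+_ (eq′ ⊤) (eq A)) (+-interchange c (ρ′ ⊤) c (ρ A))))
  (ℕₚ.[m+n]∸[m+o]≡n∸o (c + c) (ρ ⊤ + ρ′ A) (ρ′ ⊤ + ρ A))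

corank-con : ∀ (ρ : Subset (suc n) → ℕ) A → corank ρ (A ∷ʳ true) ≡ corank (con ρ) A
corank-con {n} ρ A = cong (λ E → ρ E ∸ con ρ A) (⊤-∷ʳ n)

corank-del : ∀ {ρ : Subset (suc n) → ℕ} κ → IsRank ρ → con ρ ⊤ ≡ κ + del ρ ⊤ →
             ∀ A → corank ρ (A ∷ʳ false) ≡ κ + corank (del ρ) A
corank-del {n} {ρ} κ R eq A = trans (cong (_∸ del ρ A) (trans (cong ρ (⊤-∷ʳ n)) eq))
  (ℕₚ.+-∸-assoc κ (mono R (⊆-∷ʳ false ⊆⊤)))

nullity-del : ∀ (ρ : Subset (suc n) → ℕ) A → nullity ρ (A ∷ʳ false) ≡ nullity (del ρ) A
nullity-del {n} ρ A = cong₂ (λ a E → a + ρ E ∸ del ρ A) (∣∷ʳ∣ false A) (⊥-∷ʳ n)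

-- `ℓ` is one minus the gain over `⊥`, hence 1 for a loop and 0 otherwise; `bound` keeps the
-- truncated subtraction exact.
nullity-con : ∀ {ρ : Subset (suc n) → ℕ} ℓ → IsRank ρ → suc (del ρ ⊥) ≡ ℓ + con ρ ⊥ →
              ∀ A → nullity ρ (A ∷ʳ true) ≡ ℓ + nullity (con ρ) A
nullity-con {n} {ρ} ℓ R eq A = trans (cong (_∸ con ρ A) size) (ℕₚ.+-∸-assoc ℓ bound)
  where
  open ≡-Reasoning
  size : ∣ A ∷ʳ true ∣ + ρ ⊥ ≡ ℓ + (∣ A ∣ + con ρ ⊥)
  size = begin
    ∣ A ∷ʳ true ∣ + ρ ⊥       ≡⟨ cong₂ (λ a E → a + ρ E) (∣∷ʳ∣ true A) (⊥-∷ʳ n) ⟩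
    suc ∣ A ∣ + del ρ ⊥       ≡⟨ ℕₚ.+-suc ∣ A ∣ (del ρ ⊥) ⟨
    ∣ A ∣ + suc (del ρ ⊥)     ≡⟨ cong (∣ A ∣ +_) eq ⟩
    ∣ A ∣ + (ℓ + con ρ ⊥)   ≡⟨ +-rotate ∣ A ∣ ℓ (con ρ ⊥) ⟩
    ℓ + (∣ A ∣ + con ρ ⊥)   ∎
  bound : con ρ A ≤ ∣ A ∣ + con ρ ⊥
  bound = subst₂ _≤_ (trans (cong (con ρ A +_) (∣⊥∣≡0 n)) (ℕₚ.+-identityʳ _)) (ℕₚ.+-comm (con ρ ⊥) ∣ A ∣)
    (unit (∷ʳ-isRank true R) {⊥} {A} ⊥⊆)

codrop-con : ∀ (ρ ρ′ : Subset (suc n) → ℕ) A → codrop ρ ρ′ (A ∷ʳ true) ≡ codrop (con ρ) (con ρ′) A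
codrop-con {n} ρ ρ′ A = cong (λ E → (ρ E + con ρ′ A) ∸ (ρ′ E + con ρ A)) (⊤-∷ʳ n)

-- `κ` and `κ + ζ` are the gains over `⊤` in `ρ′` and `ρ`, so `ζ` is 1 when the greatest element is
-- a coloop of M only. `quotient` keeps the truncated subtraction exact.
codrop-del : ∀ {ρ ρ′ : Subset (suc n) → ℕ} κ ζ → IsPerspective ρ ρ′ →
             con ρ′ ⊤ ≡ κ + del ρ′ ⊤ → con ρ ⊤ ≡ κ + (ζ + del ρ ⊤) →
             ∀ A → codrop ρ ρ′ (A ∷ʳ false) ≡ ζ + codrop (del ρ) (del ρ′) A
codrop-del {n} {ρ} {ρ′} κ ζ P eq′ eq A = begin
  codrop ρ ρ′ (A ∷ʳ false)
    ≡⟨ cong₂ (λ a b → (a + y) ∸ (b + x)) (trans (cong ρ (⊤-∷ʳ n)) eq) (trans (cong ρ′ (⊤-∷ʳ n)) eq′) ⟩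
  (κ + (ζ + r₀) + y) ∸ (κ + r₀′ + x)                  ≡⟨ cong₂ _∸_ (regroup κ ζ r₀ y) (ℕₚ.+-assoc κ r₀′ x) ⟩
  (κ + (ζ + (r₀ + y))) ∸ (κ + (r₀′ + x))              ≡⟨ ℕₚ.[m+n]∸[m+o]≡n∸o κ (ζ + (r₀ + y)) (r₀′ + x) ⟩
  (ζ + (r₀ + y)) ∸ (r₀′ + x)                              ≡⟨ ℕₚ.+-∸-assoc ζ (quotient P (⊆-∷ʳ false ⊆⊤)) ⟩
  ζ + codrop (del ρ) (del ρ′) A                               ∎
  where
  open ≡-Reasoning
  x y r₀ r₀′ : ℕ
  x   = del ρ A
  y   = del ρ′ A
  r₀  = del ρ ⊤
  r₀′ = del ρ′ ⊤
  regroup : ∀ a b c d → a + (b + c) + d ≡ a + (b + (c + d))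
  regroup = ℕ-Solver.solve-∀

-- Recursion for the two generating functions

-- The coefficients of uᵖvᑫxⁱyʲzᵏ in (x+u-1)ᵃ(y+v-1)ᵇzᶜ and in uᵃvᵇxˢyᵗzᶜ.
φ : (p q i j k a b c : ℕ) → ℤ
φ p q i j k a b c = taylor a p i ℤ.* (taylor b q j ℤ.* δ c k)

ψ : (p q i j k a b s t c : ℕ) → ℤ
ψ p q i j k a b s t c = δ a p ℤ.* (δ b q ℤ.* (δ s i ℤ.* (δ t j ℤ.* δ c k)))

φ-x : ∀ p q i j k a b c → φ p q i j k (suc a) b c ℤ.+ φ p q i j k a b c ≡
      shift (λ p → φ p q i j k a b c) p ℤ.+ shift (λ i → φ p q i j k a b c) i
φ-x p q i j k a b c = begin
    taylor (suc a) p i ℤ.* w ℤ.+ taylor a p i ℤ.* w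
  ≡⟨ ℤₚ.*-distribʳ-+ w (taylor (suc a) p i) (taylor a p i) ⟨
    (taylor (suc a) p i ℤ.+ taylor a p i) ℤ.* w
  ≡⟨ cong (ℤ._* w) (taylor-+ a p i) ⟩
    (shift (λ p → taylor a p i) p ℤ.+ shift (taylor a p) i) ℤ.* w
  ≡⟨ ℤₚ.*-distribʳ-+ w (shift (λ p → taylor a p i) p) (shift (taylor a p) i) ⟩
    shift (λ p → taylor a p i) p ℤ.* w ℤ.+ shift (taylor a p) i ℤ.* w
  ≡⟨ cong₂ ℤ._+_ (shift-*ʳ (λ p → taylor a p i) w p) (shift-*ʳ (taylor a p) w i) ⟩
    shift (λ p → taylor a p i ℤ.* w) p ℤ.+ shift (λ i → taylor a p i ℤ.* w) i ∎
  where
  open ≡-Reasoning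
  w : ℤ
  w = taylor b q j ℤ.* δ c k

-- Exchanging (x, u) with (y, v) preserves the kernel, so `φ-y` is `φ-x` in the other pair of
-- variables.
φ-swap : ∀ p q i j k a b c → φ p q i j k a b c ≡ φ q p j i k b a c
φ-swap p q i j k a b c = lemma (taylor a p i) (taylor b q j) (δ c k)
  where
  lemma : ∀ x y z → x ℤ.* (y ℤ.* z) ≡ y ℤ.* (x ℤ.* z)
  lemma = solve-∀

φ-y : ∀ p q i j k a b c → φ p q i j k a (suc b) c ℤ.+ φ p q i j k a b c ≡
      shift (λ q → φ p q i j k a b c) q ℤ.+ shift (λ j → φ p q i j k a b c) j
φ-y p q i j k a b c = trans (cong₂ ℤ._+_ (φ-swap p q i j k a (suc b) c) (φ-swap p q i j k a b c))
  (trans (φ-x q p j i k b a c)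
    (cong₂ ℤ._+_ (shift-cong (λ q → φ-swap q p j i k b a c) q) (shift-cong (λ j → φ-swap q p j i k b a c) j)))

φ-z : ∀ p q i j k a b c → φ p q i j k a b (suc c) ≡ shift (λ k → φ p q i j k a b c) k
φ-z p q i j k a b c = trans (cong (λ d → taylor a p i ℤ.* (taylor b q j ℤ.* d)) (δ-suc c k))
  (trans (cong (taylor a p i ℤ.*_) (shift-*ˡ (taylor b q j) (δ c) k)) (shift-*ˡ (taylor a p i) _ k))

ψ-u : ∀ p q i j k a b s t c → ψ p q i j k (suc a) b s t c ≡ shift (λ p → ψ p q i j k a b s t c) p
ψ-u zero    q i j k a b s t c = refl
ψ-u (suc p) q i j k a b s t c = refl

ψ-v : ∀ p q i j k a b s t c → ψ p q i j k a (suc b) s t c ≡ shift (λ q → ψ p q i j k a b s t c) q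
ψ-v p zero    i j k a b s t c = ℤₚ.*-zeroʳ (δ a p)
ψ-v p (suc q) i j k a b s t c = refl

ψ-x : ∀ p q i j k a b s t c → ψ p q i j k a b (suc s) t c ≡ shift (λ i → ψ p q i j k a b s t c) i
ψ-x p q zero    j k a b s t c = trans (cong (δ a p ℤ.*_) (ℤₚ.*-zeroʳ (δ b q))) (ℤₚ.*-zeroʳ (δ a p))
ψ-x p q (suc i) j k a b s t c = refl

ψ-y : ∀ p q i j k a b s t c → ψ p q i j k a b s (suc t) c ≡ shift (λ j → ψ p q i j k a b s t c) j
ψ-y p q i zero    k a b s t c = lemma (δ a p) (δ b q) (δ s i)
  where
  lemma : ∀ x y z → x ℤ.* (y ℤ.* (z ℤ.* 0ℤ)) ≡ 0ℤ
  lemma = solve-∀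
ψ-y p q i (suc j) k a b s t c = refl

ψ-z : ∀ p q i j k a b s t c → ψ p q i j k a b s t (suc c) ≡ shift (λ k → ψ p q i j k a b s t c) k
ψ-z p q i j zero    a b s t c = lemma (δ a p) (δ b q) (δ s i) (δ t j)
  where
  lemma : ∀ x y z w → x ℤ.* (y ℤ.* (z ℤ.* (w ℤ.* 0ℤ))) ≡ 0ℤ
  lemma = solve-∀
ψ-z p q i j (suc k) a b s t c = refl

module _ (ρ ρ′ : Subset n → ℕ) (p q i j k : ℕ) where

  lhs-term rhs-term : Subset n → ℤ
  lhs-term A = φ p q i j k (corank ρ′ A) (nullity ρ A) (codrop ρ ρ′ A)
  rhs-term A = ψ p q i j k (corank ρ′ A) (nullity ρ A) (int ρ′ A) (ext ρ A) (codrop ρ ρ′ A)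

  lhs rhs : ℤ
  lhs = ∑ n lhs-term
  rhs = ∑ n rhs-term

-- The recursion, by the type of the greatest element

≡ᵇ-refl : ∀ a → (a ≡ᵇ a) ≡ true
≡ᵇ-refl zero    = refl
≡ᵇ-refl (suc a) = ≡ᵇ-refl a

suc≢ᵇ : ∀ a → (suc a ≡ᵇ a) ≡ false
suc≢ᵇ zero    = refl
suc≢ᵇ (suc a) = suc≢ᵇ a

≢ᵇsuc : ∀ a → (a ≡ᵇ suc a) ≡ false
≢ᵇsuc zero    = refl
≢ᵇsuc (suc a) = ≢ᵇsuc a

φ-cong : ∀ p q i j k {a a′ b b′ c c′} → a ≡ a′ → b ≡ b′ → c ≡ c′ → φ p q i j k a b c ≡ φ p q i j k a′ b′ c′
φ-cong p q i j k refl refl refl = refl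

ψ-cong : ∀ p q i j k {a a′ b b′ s s′ t t′ c c′} → a ≡ a′ → b ≡ b′ → s ≡ s′ → t ≡ t′ → c ≡ c′ →
         ψ p q i j k a b s t c ≡ ψ p q i j k a′ b′ s′ t′ c′
ψ-cong p q i j k refl refl refl refl refl = refl

module _ {ρ ρ′ : Subset (suc n) → ℕ} (P : IsPerspective ρ ρ′) (κ ℓ ζ : ℕ)
  (ρ′⊤ : con ρ′ ⊤ ≡ κ + del ρ′ ⊤) (ρ⊤ : con ρ ⊤ ≡ κ + (ζ + del ρ ⊤)) (ρ⊥ : suc (del ρ ⊥) ≡ ℓ + con ρ ⊥)
  (κ≡ : 𝟙 (con ρ′ ⊤ ≡ᵇ suc (del ρ′ ⊤)) ≡ κ) (ℓ≡ : 𝟙 (con ρ ⊥ ≡ᵇ del ρ ⊥) ≡ ℓ)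
  (p q i j k : ℕ) where

  -- One split serves all cases: `κ`, `ℓ` and `ζ` record whether the greatest element is a coloop of
  -- M′, a loop of M, or a coloop of M but not of M′.
  lhs-split : lhs ρ ρ′ p q i j k ≡
    ∑ n (λ A → φ p q i j k (κ + corank (del ρ′) A) (nullity (del ρ) A) (ζ + codrop (del ρ) (del ρ′) A)) ℤ.+
    ∑ n (λ A → φ p q i j k (corank (con ρ′) A) (ℓ + nullity (con ρ) A) (codrop (con ρ) (con ρ′) A))
  lhs-split = trans (∑-∷ʳ n (lhs-term ρ ρ′ p q i j k)) (cong₂ ℤ._+_
    (∑-cong n λ A → φ-cong p q i j k (corank-del κ (isRank′ P) ρ′⊤ A) (nullity-del ρ A) (codrop-del κ ζ P ρ′⊤ ρ⊤ A))
    (∑-cong n λ A → φ-cong p q i j k (corank-con ρ′ A) (nullity-con ℓ (isRank P) ρ⊥ A) (codrop-con ρ ρ′ A)))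

  rhs-split : rhs ρ ρ′ p q i j k ≡
    ∑ n (λ A → ψ p q i j k (κ + corank (del ρ′) A) (nullity (del ρ) A)
                 (int (del ρ′) A) (ℓ + ext (del ρ) A) (ζ + codrop (del ρ) (del ρ′) A)) ℤ.+
    ∑ n (λ A → ψ p q i j k (corank (con ρ′) A) (ℓ + nullity (con ρ) A)
                 (κ + int (con ρ′) A) (ext (con ρ) A) (codrop (con ρ) (con ρ′) A))
  rhs-split = trans (∑-∷ʳ n (rhs-term ρ ρ′ p q i j k)) (cong₂ ℤ._+_
    (∑-cong n λ A → ψ-cong p q i j k (corank-del κ (isRank′ P) ρ′⊤ A) (nullity-del ρ A)
      (int-del ρ′ A) (trans (ext-del ρ A) (cong (_+ ext (del ρ) A) ℓ≡)) (codrop-del κ ζ P ρ′⊤ ρ⊤ A))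
    (∑-cong n λ A → ψ-cong p q i j k (corank-con ρ′ A) (nullity-con ℓ (isRank P) ρ⊥ A)
      (trans (int-con ρ′ A) (cong (_+ int (con ρ′) A) κ≡)) (ext-con ρ A) (codrop-con ρ ρ′ A)))

module _ (c : ℕ) {σ ρ σ′ ρ′ : Subset n → ℕ} (eq : ∀ A → σ A ≡ c + ρ A) (eq′ : ∀ A → σ′ A ≡ c + ρ′ A) where

  φ-shift : ∀ p q i j k d A → φ p q i j k (corank σ′ A) (d + nullity σ A) (codrop σ σ′ A) ≡
                              φ p q i j k (corank ρ′ A) (d + nullity ρ A) (codrop ρ ρ′ A)
  φ-shift p q i j k d A = φ-cong p q i j k (corank-shift c eq′ A) (cong (d +_) (nullity-shift c eq A))
    (codrop-shift c eq eq′ A)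

  ψ-shift : ∀ p q i j k d e A →
    ψ p q i j k (corank σ′ A) (d + nullity σ A) (e + int σ′ A) (ext σ A) (codrop σ σ′ A) ≡
    ψ p q i j k (corank ρ′ A) (d + nullity ρ A) (e + int ρ′ A) (ext ρ A) (codrop ρ ρ′ A)
  ψ-shift p q i j k d e A = ψ-cong p q i j k (corank-shift c eq′ A) (cong (d +_) (nullity-shift c eq A))
    (cong (e +_) (int-shift c eq′ A)) (ext-shift c eq A) (codrop-shift c eq eq′ A)

∑-shift₂ : ∀ n (g h : Subset n → ℤ) (u v : Subset n → ℕ → ℤ) p i →
           (∀ A → g A ℤ.+ h A ≡ shift (u A) p ℤ.+ shift (v A) i) →
           ∑ n g ℤ.+ ∑ n h ≡ shift (λ p → ∑ n (λ A → u A p)) p ℤ.+ shift (λ i → ∑ n (λ A → v A i)) i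
∑-shift₂ n g h u v p i eq = begin
  ∑ n g ℤ.+ ∑ n h                                                    ≡⟨ ∑-+ n g h ⟩
  ∑ n (λ A → g A ℤ.+ h A)                                            ≡⟨ ∑-cong n eq ⟩
  ∑ n (λ A → shift (u A) p ℤ.+ shift (v A) i)
    ≡⟨ ∑-+ n (λ A → shift (u A) p) (λ A → shift (v A) i) ⟨
  ∑ n (λ A → shift (u A) p) ℤ.+ ∑ n (λ A → shift (v A) i)
    ≡⟨ cong₂ ℤ._+_ (∑-shift n u p) (∑-shift n v i) ⟩
  shift (λ p → ∑ n (λ A → u A p)) p ℤ.+ shift (λ i → ∑ n (λ A → v A i)) i ∎
  where open ≡-Reasoning

-- The exponents are quantified inside the induction, because under `shift` the hypothesis is used
-- at a lowered one.
lhs≡rhs : ∀ n {ρ ρ′ : Subset n → ℕ} → IsPerspective ρ ρ′ → ∀ p q i j k → lhs ρ ρ′ p q i j k ≡ rhs ρ ρ′ p q i j k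

module _ {n} {ρ ρ′ : Subset (suc n) → ℕ} (P : IsPerspective ρ ρ′) (p q i j k : ℕ) where

  private
    ρ₀ ρ₀′ ρ₁ ρ₁′ : Subset n → ℕ
    ρ₀  = del ρ
    ρ₀′ = del ρ′
    ρ₁  = con ρ
    ρ₁′ = con ρ′
    P₀ : IsPerspective ρ₀ ρ₀′
    P₀ = ∷ʳ-isPerspective false P
    P₁ : IsPerspective ρ₁ ρ₁′
    P₁ = ∷ʳ-isPerspective true P
    a b s t c : Subset n → ℕ
    a = corank ρ₀′
    b = nullity ρ₀
    s = int ρ₀′
    t = ext ρ₀
    c = codrop ρ₀ ρ₀′

  lhs≡rhs-coloop : con ρ′ ⊤ ≡ suc (del ρ′ ⊤) → lhs ρ ρ′ p q i j k ≡ rhs ρ ρ′ p q i j k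
  lhs≡rhs-coloop eq = begin
      lhs ρ ρ′ p q i j k
    ≡⟨ lhs-split P 1 0 0 eq (coloop P eq ⊤) (sym (coloop P eq ⊥)) κ≡ ℓ≡ p q i j k ⟩
      ∑ n (λ A → φ p q i j k (suc (a A)) (b A) (c A)) ℤ.+ ∑ n _
    -- Contraction is deletion plus one in both rank functions, so the second sum can be written
    -- with the statistics of the deletion.
    ≡⟨ cong (λ r → ∑ n (λ A → φ p q i j k (suc (a A)) (b A) (c A)) ℤ.+ r)
         (∑-cong n (φ-shift 1 (coloop P eq) (coloop′ P eq) p q i j k 0)) ⟩
      ∑ n (λ A → φ p q i j k (suc (a A)) (b A) (c A)) ℤ.+ ∑ n (λ A → φ p q i j k (a A) (b A) (c A))
    ≡⟨ ∑-shift₂ n _ _ (λ A p → φ p q i j k (a A) (b A) (c A)) (λ A i → φ p q i j k (a A) (b A) (c A)) p i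
         (λ A → φ-x p q i j k (a A) (b A) (c A)) ⟩
      shift (λ p → lhs ρ₀ ρ₀′ p q i j k) p ℤ.+ shift (λ i → lhs ρ₀ ρ₀′ p q i j k) i
    ≡⟨ cong₂ ℤ._+_ (shift-cong (λ p → lhs≡rhs n P₀ p q i j k) p) (shift-cong (λ i → lhs≡rhs n P₀ p q i j k) i) ⟩
      shift (λ p → rhs ρ₀ ρ₀′ p q i j k) p ℤ.+ shift (λ i → rhs ρ₀ ρ₀′ p q i j k) i
    -- Read backwards: u comes from the sets omitting the coloop, whose corank is raised, and x from
    -- those containing it, where it is internally active.
    ≡⟨ ∑-shift₂ n _ _ (λ A p → ψ p q i j k (a A) (b A) (s A) (t A) (c A)) (λ A i → ψ p q i j k (a A) (b A) (s A) (t A) (c A)) p i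
         (λ A → cong₂ ℤ._+_ (ψ-u p q i j k (a A) (b A) (s A) (t A) (c A)) (ψ-x p q i j k (a A) (b A) (s A) (t A) (c A))) ⟨
      ∑ n (λ A → ψ p q i j k (suc (a A)) (b A) (s A) (t A) (c A)) ℤ.+ ∑ n (λ A → ψ p q i j k (a A) (b A) (suc (s A)) (t A) (c A))
    ≡⟨ cong (λ r → ∑ n (λ A → ψ p q i j k (suc (a A)) (b A) (s A) (t A) (c A)) ℤ.+ r)
         (∑-cong n (ψ-shift 1 (coloop P eq) (coloop′ P eq) p q i j k 0 1)) ⟨
      ∑ n (λ A → ψ p q i j k (suc (a A)) (b A) (s A) (t A) (c A)) ℤ.+ ∑ n _
    ≡⟨ rhs-split P 1 0 0 eq (coloop P eq ⊤) (sym (coloop P eq ⊥)) κ≡ ℓ≡ p q i j k ⟨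
      rhs ρ ρ′ p q i j k ∎
    where
    open ≡-Reasoning
    κ≡ : 𝟙 (con ρ′ ⊤ ≡ᵇ suc (del ρ′ ⊤)) ≡ 1
    κ≡ = cong 𝟙 (trans (cong (_≡ᵇ suc (del ρ′ ⊤)) eq) (≡ᵇ-refl (del ρ′ ⊤)))
    ℓ≡ : 𝟙 (con ρ ⊥ ≡ᵇ del ρ ⊥) ≡ 0
    ℓ≡ = cong 𝟙 (trans (cong (_≡ᵇ del ρ ⊥) (coloop P eq ⊥)) (suc≢ᵇ (del ρ ⊥)))

  lhs≡rhs-loop : con ρ ⊥ ≡ del ρ ⊥ → lhs ρ ρ′ p q i j k ≡ rhs ρ ρ′ p q i j k
  lhs≡rhs-loop eq = begin
      lhs ρ ρ′ p q i j k
    ≡⟨ lhs-split P 0 1 0 (loop′ P eq ⊤) (loop P eq ⊤) (cong suc (sym eq)) κ≡ ℓ≡ p q i j k ⟩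
      ∑ n (λ A → φ p q i j k (a A) (b A) (c A)) ℤ.+ ∑ n _
    ≡⟨ cong (λ r → ∑ n (λ A → φ p q i j k (a A) (b A) (c A)) ℤ.+ r)
         (∑-cong n (φ-shift 0 (loop P eq) (loop′ P eq) p q i j k 1)) ⟩
      ∑ n (λ A → φ p q i j k (a A) (b A) (c A)) ℤ.+ ∑ n (λ A → φ p q i j k (a A) (suc (b A)) (c A))
    -- The shift in `j` is put before the one in `q`, because on the right the sets omitting the
    -- loop supply y and those containing it supply v.
    ≡⟨ ∑-shift₂ n _ _ (λ A j → φ p q i j k (a A) (b A) (c A)) (λ A q → φ p q i j k (a A) (b A) (c A)) j q
         (λ A → trans (ℤₚ.+-comm (φ p q i j k (a A) (b A) (c A)) _)
           (trans (φ-y p q i j k (a A) (b A) (c A)) (ℤₚ.+-comm (shift (λ q → φ p q i j k (a A) (b A) (c A)) q) _))) ⟩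
      shift (λ j → lhs ρ₀ ρ₀′ p q i j k) j ℤ.+ shift (λ q → lhs ρ₀ ρ₀′ p q i j k) q
    ≡⟨ cong₂ ℤ._+_ (shift-cong (λ j → lhs≡rhs n P₀ p q i j k) j) (shift-cong (λ q → lhs≡rhs n P₀ p q i j k) q) ⟩
      shift (λ j → rhs ρ₀ ρ₀′ p q i j k) j ℤ.+ shift (λ q → rhs ρ₀ ρ₀′ p q i j k) q
    ≡⟨ ∑-shift₂ n _ _ (λ A j → ψ p q i j k (a A) (b A) (s A) (t A) (c A)) (λ A q → ψ p q i j k (a A) (b A) (s A) (t A) (c A)) j q
         (λ A → cong₂ ℤ._+_ (ψ-y p q i j k (a A) (b A) (s A) (t A) (c A)) (ψ-v p q i j k (a A) (b A) (s A) (t A) (c A))) ⟨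
      ∑ n (λ A → ψ p q i j k (a A) (b A) (s A) (suc (t A)) (c A)) ℤ.+ ∑ n (λ A → ψ p q i j k (a A) (suc (b A)) (s A) (t A) (c A))
    ≡⟨ cong (λ r → ∑ n (λ A → ψ p q i j k (a A) (b A) (s A) (suc (t A)) (c A)) ℤ.+ r)
         (∑-cong n (ψ-shift 0 (loop P eq) (loop′ P eq) p q i j k 1 0)) ⟨
      ∑ n (λ A → ψ p q i j k (a A) (b A) (s A) (suc (t A)) (c A)) ℤ.+ ∑ n _
    ≡⟨ rhs-split P 0 1 0 (loop′ P eq ⊤) (loop P eq ⊤) (cong suc (sym eq)) κ≡ ℓ≡ p q i j k ⟨
      rhs ρ ρ′ p q i j k ∎
    where
    open ≡-Reasoning
    κ≡ : 𝟙 (con ρ′ ⊤ ≡ᵇ suc (del ρ′ ⊤)) ≡ 0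
    κ≡ = cong 𝟙 (trans (cong (_≡ᵇ suc (del ρ′ ⊤)) (loop′ P eq ⊤)) (≢ᵇsuc (del ρ′ ⊤)))
    ℓ≡ : 𝟙 (con ρ ⊥ ≡ᵇ del ρ ⊥) ≡ 1
    ℓ≡ = cong 𝟙 (trans (cong (_≡ᵇ del ρ ⊥) eq) (≡ᵇ-refl (del ρ ⊥)))

  lhs≡rhs-generic : con ρ′ ⊤ ≡ del ρ′ ⊤ → con ρ ⊥ ≡ suc (del ρ ⊥) → lhs ρ ρ′ p q i j k ≡ rhs ρ ρ′ p q i j k
  lhs≡rhs-generic eq′ eq with del-or-suc (isRank P) ⊤
  ... | inj₁ e = trans (lhs-split P 0 0 0 eq′ e (sym eq) κ≡ ℓ≡ p q i j k)
    (trans (cong₂ ℤ._+_ (lhs≡rhs n P₀ p q i j k) (lhs≡rhs n P₁ p q i j k))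
      (sym (rhs-split P 0 0 0 eq′ e (sym eq) κ≡ ℓ≡ p q i j k)))
    where
    κ≡ : 𝟙 (con ρ′ ⊤ ≡ᵇ suc (del ρ′ ⊤)) ≡ 0
    κ≡ = cong 𝟙 (trans (cong (_≡ᵇ suc (del ρ′ ⊤)) eq′) (≢ᵇsuc (del ρ′ ⊤)))
    ℓ≡ : 𝟙 (con ρ ⊥ ≡ᵇ del ρ ⊥) ≡ 0
    ℓ≡ = cong 𝟙 (trans (cong (_≡ᵇ del ρ ⊥) eq) (suc≢ᵇ (del ρ ⊥)))
  -- A coloop of M but not of M′: omitting it costs rank in M only, so the codrop exceeds that in
  -- the deletion by one.
  ... | inj₂ e = begin
      lhs ρ ρ′ p q i j k
    ≡⟨ lhs-split P 0 0 1 eq′ e (sym eq) κ≡ ℓ≡ p q i j k ⟩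
      ∑ n (λ A → φ p q i j k (a A) (b A) (suc (c A))) ℤ.+ lhs ρ₁ ρ₁′ p q i j k
    ≡⟨ cong₂ ℤ._+_ (trans (∑-cong n λ A → φ-z p q i j k (a A) (b A) (c A)) (∑-shift n (λ A k → φ p q i j k (a A) (b A) (c A)) k))
         (lhs≡rhs n P₁ p q i j k) ⟩
      shift (λ k → lhs ρ₀ ρ₀′ p q i j k) k ℤ.+ rhs ρ₁ ρ₁′ p q i j k
    ≡⟨ cong (ℤ._+ rhs ρ₁ ρ₁′ p q i j k) (shift-cong (λ k → lhs≡rhs n P₀ p q i j k) k) ⟩
      shift (λ k → rhs ρ₀ ρ₀′ p q i j k) k ℤ.+ rhs ρ₁ ρ₁′ p q i j k
    ≡⟨ cong (ℤ._+ rhs ρ₁ ρ₁′ p q i j k)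
         (trans (∑-cong n λ A → ψ-z p q i j k (a A) (b A) (s A) (t A) (c A))
           (∑-shift n (λ A k → ψ p q i j k (a A) (b A) (s A) (t A) (c A)) k)) ⟨
      ∑ n (λ A → ψ p q i j k (a A) (b A) (s A) (t A) (suc (c A))) ℤ.+ rhs ρ₁ ρ₁′ p q i j k
    ≡⟨ rhs-split P 0 0 1 eq′ e (sym eq) κ≡ ℓ≡ p q i j k ⟨
      rhs ρ ρ′ p q i j k ∎
    where
    open ≡-Reasoning
    κ≡ : 𝟙 (con ρ′ ⊤ ≡ᵇ suc (del ρ′ ⊤)) ≡ 0
    κ≡ = cong 𝟙 (trans (cong (_≡ᵇ suc (del ρ′ ⊤)) eq′) (≢ᵇsuc (del ρ′ ⊤)))
    ℓ≡ : 𝟙 (con ρ ⊥ ≡ᵇ del ρ ⊥) ≡ 0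
    ℓ≡ = cong 𝟙 (trans (cong (_≡ᵇ del ρ ⊥) eq) (suc≢ᵇ (del ρ ⊥)))

lhs≡rhs zero {ρ} {ρ′} P p q i j k
  rewrite ℕₚ.n∸n≡0 (ρ []) | ℕₚ.n∸n≡0 (ρ′ []) | ℕₚ.+-comm (ρ []) (ρ′ []) | ℕₚ.n∸n≡0 (ρ′ [] + ρ []) =
  lemma (δ 0 p) (δ 0 q) (δ 0 i) (δ 0 j) (δ 0 k)
  where
  lemma : ∀ p q i j k → p ℤ.* i ℤ.* (q ℤ.* j ℤ.* k) ≡ p ℤ.* (q ℤ.* (i ℤ.* (j ℤ.* k)))
  lemma = solve-∀
lhs≡rhs (suc n) P p q i j k with del-or-suc (isRank′ P) ⊤ | del-or-suc (isRank P) ⊥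
... | inj₂ coloop | _           = lhs≡rhs-coloop P p q i j k coloop
... | inj₁ _      | inj₁ loop   = lhs≡rhs-loop P p q i j k loop
... | inj₁ eq′    | inj₂ eq     = lhs≡rhs-generic P p q i j k eq′ eq

-- Boolean reflection

T-⇔-≡ : ∀ {a b} → (T a → T b) → (T b → T a) → a ≡ b
T-⇔-≡ {false} {false} f g = refl
T-⇔-≡ {false} {true}  f g = ⊥-elim (g _)
T-⇔-≡ {true}  {false} f g = ⊥-elim (f _)
T-⇔-≡ {true}  {true}  f g = refl

∈-subsets : (A : Subset n) → A ∈ₗ subsets n
∈-subsets []          = Any.here refl
∈-subsets (false ∷ A) = ∈-++⁺ˡ (∈-map⁺ (false ∷_) (∈-subsets A))
∈-subsets (true ∷ A)  = ∈-++⁺ʳ _ (∈-map⁺ (true ∷_) (∈-subsets A))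

∈ᵇ⇒∈ : ∀ {e} {A : Subset n} → T (e ∈ᵇ A) → e ∈ A
∈ᵇ⇒∈ {e = e} {A} p = lookup⇒[]= e A (to T-≡ p)

∈⇒∈ᵇ : ∀ {e} {A : Subset n} → e ∈ A → T (e ∈ᵇ A)
∈⇒∈ᵇ p = from T-≡ ([]=⇒lookup p)

⊆ᵇ⇒⊆ : ∀ (A B : Subset n) → T (A ⊆ᵇ B) → A ⊆ B
⊆ᵇ⇒⊆ (false ∷ A) (b ∷ B)    p = out⊆ (⊆ᵇ⇒⊆ A B p)
⊆ᵇ⇒⊆ (true ∷ A)  (true ∷ B) p = s⊆s (⊆ᵇ⇒⊆ A B p)
⊆ᵇ⇒⊆ []          []         p = λ e∈ → e∈

⊆⇒⊆ᵇ : ∀ (A B : Subset n) → A ⊆ B → T (A ⊆ᵇ B)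
⊆⇒⊆ᵇ []          []          A⊆B = _
⊆⇒⊆ᵇ (false ∷ A) (b ∷ B)     A⊆B = ⊆⇒⊆ᵇ A B (drop-∷-⊆ A⊆B)
⊆⇒⊆ᵇ (true ∷ A)  (true ∷ B)  A⊆B = ⊆⇒⊆ᵇ A B (drop-∷-⊆ A⊆B)
⊆⇒⊆ᵇ (true ∷ A)  (false ∷ B) A⊆B with () ← A⊆B here

record IsCircuit (ρ : Subset n → ℕ) (C : Subset n) : Set where
  field
    dependent : ρ C < ∣ C ∣
    minimal   : ∀ {B} → B ⊆ C → ρ B < ∣ B ∣ → C ⊆ B

open IsCircuit

private
  -- The truth function of the minimality clause in `circuitR`, with x, y, z standing for B ⊆ C, C ⊆
  -- B and dependence of B.
  proper⇒independent : Bool → Bool → Bool → Bool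
  proper⇒independent x y z = not (x ∧ not (x ∧ y)) ∨ not z

  apply : ∀ x y z → T (proper⇒independent x y z) → T x → T z → T y
  apply true true true _ _ _ = _

  abstr : ∀ x y z → (T x → T z → T y) → T (proper⇒independent x y z)
  abstr false y     z     f = _
  abstr true  true  z     f = _
  abstr true  false false f = _
  abstr true  false true  f = f _ _

circuitR⇒IsCircuit : ∀ {ρ : Subset n → ℕ} {C} → T (circuitR ρ C) → IsCircuit ρ C
circuitR⇒IsCircuit {ρ = ρ} {C} p = record
  { dependent = ℕₚ.<ᵇ⇒< _ _ (proj₁ (to T-∧ p))
  ; minimal   = λ {B} B⊆C dep → ⊆ᵇ⇒⊆ C B (apply (B ⊆ᵇ C) (C ⊆ᵇ B) (dependentR ρ B)
      (All.lookup (Allₚ.all⁺ _ (subsets _) (proj₂ (to (T-∧ {dependentR ρ C}) p))) (∈-subsets B)) (⊆⇒⊆ᵇ B C B⊆C) (ℕₚ.<⇒<ᵇ dep))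
  }

IsCircuit⇒circuitR : ∀ {ρ : Subset n → ℕ} {C} → IsCircuit ρ C → T (circuitR ρ C)
IsCircuit⇒circuitR {ρ = ρ} {C} c = from T-∧ (ℕₚ.<⇒<ᵇ (dependent c) , Allₚ.all⁻ _ (All.universal (λ B →
  abstr (B ⊆ᵇ C) (C ⊆ᵇ B) (dependentR ρ B) λ B⊆C dep →
    ⊆⇒⊆ᵇ C B (minimal c (⊆ᵇ⇒⊆ B C B⊆C) (ℕₚ.<ᵇ⇒< _ _ dep))) (subsets _)))

-- Circuits and closure

-- Greedy removal: the head is dropped whenever what remains still satisfies `P`. By upward closure
-- a head that had to stay lies in every subset of S satisfying `P`.
minimal-subset : ∀ {P : Subset n → Set} → (∀ A → Dec (P A)) → (∀ {A B} → A ⊆ B → P A → P B) → ∀ S → P S →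
                 ∃ λ C → C ⊆ S × P C × (∀ {B} → B ⊆ C → P B → C ⊆ B)
minimal-subset P? up [] pS = [] , (λ e∈ → e∈) , pS , λ { {[]} _ _ e∈ → e∈ }
minimal-subset {P = P} P? up (b ∷ S) pS with P? (false ∷ S)
... | yes p with C , C⊆S , pC , min ← minimal-subset (P? ∘ (false ∷_)) (up ∘ s⊆s) S p =
  false ∷ C , out⊆ C⊆S , pC , λ { {_ ∷ B} B⊆C pB → out⊆ (min (drop-∷-⊆ B⊆C) (subst (λ x → P (x ∷ B)) (outside-head B⊆C) pB)) }
  where
  outside-head : ∀ {x} {A B : Subset n} → x ∷ A ⊆ false ∷ B → x ≡ false
  outside-head {x = false} A⊆B = refl
  outside-head {x = true}  A⊆B with () ← A⊆B here
minimal-subset {P = P} P? up (false ∷ S) pS | no ¬p = ⊥-elim (¬p pS)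
minimal-subset {P = P} P? up (true ∷ S) pS  | no ¬p
  with C , C⊆S , pC , min ← minimal-subset (P? ∘ (true ∷_)) (up ∘ s⊆s) S pS = true ∷ C , s⊆s C⊆S , pC ,
  λ { {true ∷ B}  B⊆C pB → s⊆s (min (drop-∷-⊆ B⊆C) pB)
    ; {false ∷ B} B⊆C pB → ⊥-elim (¬p (up (s⊆s (⊆-trans (drop-∷-⊆ B⊆C) C⊆S)) pB)) }

-- A greedy basis, contracting each head that lies in S. Independence is measured from `ρ ⊥` since
-- the recursion runs through contractions; a loop is contracted too, but then left out of I.
basis : ∀ {ρ : Subset n → ℕ} → IsRank ρ → ∀ S → ∃ λ I → I ⊆ S × ρ I ≡ ρ ⊥ + ∣ I ∣ × ρ I ≡ ρ S
basis R [] = [] , (λ e∈ → e∈) , sym (ℕₚ.+-identityʳ _) , refl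
basis R (false ∷ S) with I , I⊆S , ind , span ← basis (∷-isRank false R) S = false ∷ I , s⊆s I⊆S , ind , span
basis {n = suc n} {ρ} R (true ∷ S) with I , I⊆S , ind , span ← basis (∷-isRank true R) S
  with ℕₚ.m≤n⇒m<n∨m≡n (mono R (out⊆ {s = true} (⊆-refl {x = ⊥})))
... | inj₁ lt = true ∷ I , s⊆s I⊆S , trans ind (trans (cong (_+ ∣ I ∣) one) (sym (ℕₚ.+-suc (ρ ⊥) ∣ I ∣))) , span
  where
  one : ρ (true ∷ ⊥) ≡ suc (ρ ⊥)
  one = ℕₚ.≤-antisym (ℕₚ.+-cancelʳ-≤ ∣ ⊥ {n} ∣ _ _ (subst (ρ (true ∷ ⊥) + ∣ ⊥ {n} ∣ ≤_) (ℕₚ.+-suc (ρ ⊥) _)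
    (unit R (out⊆ {s = true} (⊆-refl {x = ⊥}))))) lt
... | inj₂ eq = false ∷ I , out⊆ I⊆S , trans same (trans ind (cong (_+ ∣ I ∣) (sym eq))) , trans same span
  where
  same : ρ (false ∷ I) ≡ ρ (true ∷ I)
  same = ℕₚ.≤-antisym (mono R (out⊆ ⊆-refl)) (ℕₚ.+-cancelʳ-≤ (ρ ⊥) _ _
    (subst (ρ (true ∷ I) + ρ ⊥ ≤_) (trans (cong (_+ ρ (false ∷ I)) (sym eq)) (ℕₚ.+-comm (ρ ⊥) _))
      (diminish R (s⊆s (q⊆p∪q ⊥ I)) (s⊆s ⊥⊆))))

x∉p-x : ∀ (A : Subset n) e → e ∉ A - e
x∉p-x (_ ∷ A) (suc e) (there p) = x∉p-x A e p

∣p∣≡1+∣p-x∣ : ∀ {A : Subset n} {e} → e ∈ A → ∣ A ∣ ≡ suc ∣ A - e ∣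
∣p∣≡1+∣p-x∣ {A = true ∷ A}  here      = cong (suc ∘ ∣_∣) (sym (p─⊥≡p A))
∣p∣≡1+∣p-x∣ {A = false ∷ A} (there p) = ∣p∣≡1+∣p-x∣ p
∣p∣≡1+∣p-x∣ {A = true ∷ A}  (there p) = cong suc (∣p∣≡1+∣p-x∣ p)

⊆∪⁅⁆⇒⊆ : ∀ {A S : Subset n} {e} → e ∉ A → A ⊆ S ∪ ⁅ e ⁆ → A ⊆ S
⊆∪⁅⁆⇒⊆ {A = A} {S} {e} e∉A A⊆ {x} x∈A with x∈p∪q⁻ S ⁅ e ⁆ (A⊆ x∈A)
... | inj₁ x∈S = x∈S
... | inj₂ x∈e = ⊥-elim (e∉A (subst (_∈ A) (x∈⁅y⁆⇒x≡y e x∈e) x∈A))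

∪⁅⁆-mono : ∀ {A B : Subset n} {e} → A ⊆ B → A ∪ ⁅ e ⁆ ⊆ B ∪ ⁅ e ⁆
∪⁅⁆-mono {A = A} {B} {e} A⊆B x∈ with x∈p∪q⁻ A ⁅ e ⁆ x∈
... | inj₁ x∈A = p⊆p∪q ⁅ e ⁆ (A⊆B x∈A)
... | inj₂ x∈e = q⊆p∪q B ⁅ e ⁆ x∈e

module _ {ρ : Subset n → ℕ} (R : IsRank ρ) where

  dependent-up : ∀ {A B} → A ⊆ B → ρ A < ∣ A ∣ → ρ B < ∣ B ∣
  dependent-up {A} {B} A⊆B dep = ℕₚ.+-cancelʳ-< ∣ A ∣ _ _ (ℕₚ.≤-<-trans (unit R A⊆B)
    (subst (ρ A + ∣ B ∣ <_) (ℕₚ.+-comm ∣ A ∣ ∣ B ∣) (ℕₚ.+-monoˡ-< ∣ B ∣ dep)))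

  -- Adding e to a basis I of S gives a dependent set, its rank being at most that of S. A minimal
  -- dependent subset must contain e, as I is independent.
  closure⇒circuit : ρ ⊥ ≡ 0 → ∀ {S e} → e ∉ S → ρ (S ∪ ⁅ e ⁆) ≤ ρ S →
                    ∃ λ C → IsCircuit ρ C × e ∈ C × C ⊆ S ∪ ⁅ e ⁆
  closure⇒circuit ρ⊥ {S} {e} e∉S cl with basis R S
  ... | I , I⊆S , ind , span
    with minimal-subset (λ A → ρ A ℕₚ.<? ∣ A ∣) dependent-up (I ∪ ⁅ e ⁆) I∪e-dependent
    where
    open ℕₚ.≤-Reasoning
    I∪e-dependent : ρ (I ∪ ⁅ e ⁆) < ∣ I ∪ ⁅ e ⁆ ∣
    I∪e-dependent = begin-strict
      ρ (I ∪ ⁅ e ⁆)   ≤⟨ mono R (∪⁅⁆-mono I⊆S) ⟩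
      ρ (S ∪ ⁅ e ⁆)   ≤⟨ cl ⟩
      ρ S             ≡⟨ span ⟨
      ρ I             ≡⟨ ind ⟩
      ρ ⊥ + ∣ I ∣   ≡⟨ cong (_+ ∣ I ∣) ρ⊥ ⟩
      ∣ I ∣           <⟨ p⊂q⇒∣p∣<∣q∣ (p⊆p∪q {p = I} ⁅ e ⁆ , e , q⊆p∪q I ⁅ e ⁆ (x∈⁅x⁆ e) , e∉S ∘ I⊆S) ⟩
      ∣ I ∪ ⁅ e ⁆ ∣   ∎
  ... | C , C⊆ , dep , min = C , record { dependent = dep ; minimal = min } , e∈C , ∪⁅⁆-mono I⊆S ∘ C⊆
    where
    e∈C : e ∈ C
    e∈C with e ∈? C
    ... | yes e∈ = e∈
    ... | no e∉  = ⊥-elim (ℕₚ.<-irrefl (trans ind (cong (_+ ∣ I ∣) ρ⊥)) (dependent-up (⊆∪⁅⁆⇒⊆ e∉ C⊆) dep))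

  -- By minimality `C - e` is independent, so e adds no rank to it; submodularity carries this over
  -- to the larger set S.
  circuit⇒closure : ∀ {C S e} → IsCircuit ρ C → e ∈ C → C ⊆ S ∪ ⁅ e ⁆ → ρ (S ∪ ⁅ e ⁆) ≤ ρ S
  circuit⇒closure {C} {S} {e} circ e∈C C⊆ = ℕₚ.+-cancelʳ-≤ (ρ (C - e)) _ _ (begin
    ρ (S ∪ ⁅ e ⁆) + ρ (C - e)   ≤⟨ diminish R S∪e⊆ C-e⊆ ⟩
    ρ C + ρ S                   ≤⟨ ℕₚ.+-monoˡ-≤ (ρ S) ρC≤ ⟩
    ρ (C - e) + ρ S             ≡⟨ ℕₚ.+-comm (ρ (C - e)) (ρ S) ⟩
    ρ S + ρ (C - e)             ∎)
    where
    open ℕₚ.≤-Reasoning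
    C-e⊆C : C - e ⊆ C
    C-e⊆C = p─q⊆p C ⁅ e ⁆
    ρC≤ : ρ C ≤ ρ (C - e)
    ρC≤ = ℕₚ.≤-trans (s≤s⁻¹ (subst (ρ C <_) (∣p∣≡1+∣p-x∣ e∈C) (dependent circ)))
      (ℕₚ.≮⇒≥ λ dep → x∉p-x C e (minimal circ C-e⊆C dep e∈C))
    S∪e⊆ : S ∪ ⁅ e ⁆ ⊆ C ∪ S
    S∪e⊆ x∈ with x∈p∪q⁻ S ⁅ e ⁆ x∈
    ... | inj₁ x∈S = q⊆p∪q C S x∈S
    ... | inj₂ x∈e = p⊆p∪q S (subst (_∈ C) (sym (x∈⁅y⁆⇒x≡y e x∈e)) e∈C)
    C-e⊆ : C - e ⊆ C ∩ S
    C-e⊆ x∈ = x∈p∩q⁺ (C-e⊆C x∈ , ⊆∪⁅⁆⇒⊆ (x∉p-x C e) (C⊆ ∘ C-e⊆C) x∈)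

-- Activities in terms of rank

above : Fin n → Subset n → Subset n
above zero    (_ ∷ A) = false ∷ A
above (suc e) (_ ∷ A) = false ∷ above e A

above⁺ : ∀ {A : Subset n} {e f} → f ∈ A → toℕ e < toℕ f → f ∈ above e A
above⁺ {e = zero}  (there f∈A) e<f = there f∈A
above⁺ {e = suc e} (there f∈A) e<f = there (above⁺ f∈A (s≤s⁻¹ e<f))

above⁻ : ∀ (A : Subset n) {e f} → f ∈ above e A → f ∈ A × toℕ e < toℕ f
above⁻ (_ ∷ A) {zero}  (there f∈A) = there f∈A , s≤s z≤n
above⁻ (_ ∷ A) {suc e} (there f∈) with f∈A , e<f ← above⁻ A f∈ = there f∈A , s≤s e<f

smallestIn⇒ : ∀ {e : Fin n} {C} → T (smallestIn e C) → e ∈ C × (∀ {f} → f ∈ C → toℕ e ≤ toℕ f)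
smallestIn⇒ {e = e} {C} p = ∈ᵇ⇒∈ (proj₁ (to (T-∧ {e ∈ᵇ C}) p)) , λ {f} f∈C →
  ℕₚ.≤ᵇ⇒≤ _ _ (modus (f ∈ᵇ C) (All.lookup (Allₚ.all⁺ _ (allFin _) (proj₂ (to (T-∧ {e ∈ᵇ C}) p))) (∈-allFin f)) (∈⇒∈ᵇ f∈C))
  where
  modus : ∀ x {y} → T (not x ∨ y) → T x → T y
  modus true t _ = t

⇒smallestIn : ∀ {e : Fin n} {C} → e ∈ C → (∀ {f} → f ∈ C → toℕ e ≤ toℕ f) → T (smallestIn e C)
⇒smallestIn {e = e} {C} e∈C e≤ = from T-∧ (∈⇒∈ᵇ e∈C , Allₚ.all⁻ _ (All.universal
  (λ f → implies (f ∈ᵇ C) (λ f∈C → ℕₚ.≤⇒≤ᵇ (e≤ (∈ᵇ⇒∈ f∈C)))) (allFin _)))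
  where
  implies : ∀ x {y} → (T x → T y) → T (not x ∨ y)
  implies false f = _
  implies true  f = f _

extAt : (Subset n → ℕ) → Subset n → Fin n → Bool
extAt ρ A e = not (e ∈ᵇ A) ∧ (ρ (above e A ∪ ⁅ e ⁆) ≡ᵇ ρ (above e A))

module _ (N : Matroid n) where

  private
    ρ : Subset n → ℕ
    ρ = rank N

  rank-⊥ : ρ ⊥ ≡ 0
  rank-⊥ = ℕₚ.n≤0⇒n≡0 (subst (ρ ⊥ ≤_) (∣⊥∣≡0 n) (rank-bound N ⊥))

  rank-∪ : ∀ A B → ρ (A ∪ B) ≤ ρ A + ∣ B ∣
  rank-∪ A B = ℕₚ.≤-trans (ℕₚ.m≤m+n _ _) (ℕₚ.≤-trans (rank-submod N A B) (ℕₚ.+-monoʳ-≤ (ρ A) (rank-bound N B)))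

∣p∣+∣q∩∁p∣≡∣q∣ : ∀ (A B : Subset n) → A ⊆ B → ∣ A ∣ + ∣ B ∩ ∁ A ∣ ≡ ∣ B ∣
∣p∣+∣q∩∁p∣≡∣q∣ []          []          A⊆B = refl
∣p∣+∣q∩∁p∣≡∣q∣ (false ∷ A) (false ∷ B) A⊆B = ∣p∣+∣q∩∁p∣≡∣q∣ A B (drop-∷-⊆ A⊆B)
∣p∣+∣q∩∁p∣≡∣q∣ (false ∷ A) (true ∷ B)  A⊆B = trans (ℕₚ.+-suc ∣ A ∣ _) (cong suc (∣p∣+∣q∩∁p∣≡∣q∣ A B (drop-∷-⊆ A⊆B)))
∣p∣+∣q∩∁p∣≡∣q∣ (true ∷ A)  (true ∷ B)  A⊆B = cong suc (∣p∣+∣q∩∁p∣≡∣q∣ A B (drop-∷-⊆ A⊆B))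
∣p∣+∣q∩∁p∣≡∣q∣ (true ∷ A)  (false ∷ B) A⊆B with () ← A⊆B here

rank-isRank : (N : Matroid n) → IsRank (rank N)
rank-isRank N = record
  { mono   = λ {A} {B} → rank-mono N A B
  ; unit   = λ {A} {B} A⊆B → begin
      rank N B + ∣ A ∣                          ≤⟨ ℕₚ.+-monoˡ-≤ ∣ A ∣ (rank-mono N _ _ (cover A B)) ⟩
      rank N (A ∪ (B ∩ ∁ A)) + ∣ A ∣            ≤⟨ ℕₚ.+-monoˡ-≤ ∣ A ∣ (rank-∪ N A (B ∩ ∁ A)) ⟩
      rank N A + ∣ B ∩ ∁ A ∣ + ∣ A ∣          ≡⟨ swap (rank N A) (∣ B ∩ ∁ A ∣) (∣ A ∣) ⟩
      rank N A + (∣ A ∣ + ∣ B ∩ ∁ A ∣)        ≡⟨ cong (rank N A +_) (∣p∣+∣q∩∁p∣≡∣q∣ A B A⊆B) ⟩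
      rank N A + ∣ B ∣                          ∎
  ; submod = rank-submod N
  }
  where
  open ℕₚ.≤-Reasoning
  swap : ∀ a b c → a + b + c ≡ a + (c + b)
  swap = ℕ-Solver.solve-∀
  cover : ∀ A B → B ⊆ A ∪ (B ∩ ∁ A)
  cover A B {x} x∈B with x ∈? A
  ... | yes x∈A = p⊆p∪q _ x∈A
  ... | no x∉A  = q⊆p∪q A _ (x∈p∩q⁺ (x∈B , x∉p⇒x∈∁p x∉A))

-- A circuit inside A ∪ {e} has e as its least element exactly when its other elements lie in
-- `above e A`, so such a circuit exists if and only if e is in the closure of that set.
inExt≡extAt : ∀ (N : Matroid n) A e → inExt N A e ≡ extAt (rank N) A e
inExt≡extAt {n} N A e = cong (not (e ∈ᵇ A) ∧_) (T-⇔-≡ circuit⇒rank rank⇒circuit)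
  where
  R : IsRank (rank N)
  R = rank-isRank N
  S : Subset n
  S = above e A
  test : Subset n → Bool
  test C = isCircuit N C ∧ (C ⊆ᵇ (A ∪ ⁅ e ⁆)) ∧ smallestIn e C
  e∉S : e ∉ S
  e∉S e∈S = ℕₚ.<-irrefl refl (proj₂ (above⁻ A e∈S))

  circuit⇒rank : T (any test (subsets n)) → T (rank N (S ∪ ⁅ e ⁆) ≡ᵇ rank N S)
  circuit⇒rank p with Any.satisfied (Anyₚ.any⁻ test (subsets n) p)
  ... | C , c with circ , c′ ← to (T-∧ {isCircuit N C}) c
    with C⊆ , small ← to (T-∧ {C ⊆ᵇ (A ∪ ⁅ e ⁆)}) c′
    with e∈C , e≤ ← smallestIn⇒ {C = C} small =
    ℕₚ.≡⇒≡ᵇ _ _ (ℕₚ.≤-antisym (circuit⇒closure R (circuitR⇒IsCircuit circ) e∈C C⊆S∪e) (mono R (p⊆p∪q ⁅ e ⁆)))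
    where
    C⊆S∪e : C ⊆ S ∪ ⁅ e ⁆
    C⊆S∪e {x} x∈C with x∈p∪q⁻ A ⁅ e ⁆ (⊆ᵇ⇒⊆ C _ C⊆ x∈C) | ℕₚ.m≤n⇒m<n∨m≡n (e≤ x∈C)
    ... | inj₂ x∈e | _         = q⊆p∪q S ⁅ e ⁆ x∈e
    ... | inj₁ x∈A | inj₁ e<x  = p⊆p∪q ⁅ e ⁆ (above⁺ x∈A e<x)
    ... | inj₁ x∈A | inj₂ e≡x  = q⊆p∪q S ⁅ e ⁆ (subst (_∈ ⁅ e ⁆) (toℕ-injective e≡x) (x∈⁅x⁆ e))

  rank⇒circuit : T (rank N (S ∪ ⁅ e ⁆) ≡ᵇ rank N S) → T (any test (subsets n))
  rank⇒circuit p with closure⇒circuit R (rank-⊥ N) e∉S (ℕₚ.≤-reflexive (ℕₚ.≡ᵇ⇒≡ _ _ p))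
  ... | C , circ , e∈C , C⊆ = Anyₚ.any⁺ test (Any.map (λ { refl → from T-∧ (IsCircuit⇒circuitR circ ,
      from T-∧ (⊆⇒⊆ᵇ C _ (∪⁅⁆-mono (proj₁ ∘ above⁻ A) ∘ C⊆) , ⇒smallestIn e∈C e≤)) }) (∈-subsets C))
    where
    e≤ : ∀ {f} → f ∈ C → toℕ e ≤ toℕ f
    e≤ f∈C with x∈p∪q⁻ S ⁅ e ⁆ (C⊆ f∈C)
    ... | inj₁ f∈S = ℕₚ.<⇒≤ (proj₂ (above⁻ A f∈S))
    ... | inj₂ f∈e = ℕₚ.≤-reflexive (cong toℕ (sym (x∈⁅y⁆⇒x≡y e f∈e)))

countB-cong : ∀ {A : Set} {P Q : A → Bool} → (∀ x → P x ≡ Q x) → ∀ xs → countB P xs ≡ countB Q xs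
countB-cong P≗Q []       = refl
countB-cong P≗Q (x ∷ xs) = cong₂ (λ b c → if b then suc c else c) (P≗Q x) (countB-cong P≗Q xs)

countB-tabulate-suc : ∀ {m} (P : Fin (suc n) → Bool) (f : Fin m → Fin n) →
                      countB P (tabulate (suc ∘ f)) ≡ countB (P ∘ suc) (tabulate f)
countB-tabulate-suc {m = zero}  P f = refl
countB-tabulate-suc {m = suc m} P f = cong (λ c → if P (suc (f zero)) then suc c else c) (countB-tabulate-suc P (f ∘ suc))

if-suc : ∀ b m → (if b then suc m else m) ≡ 𝟙 b + m
if-suc false m = refl
if-suc true  m = refl

-- Every set `above (suc e)` has false at its head, so passing to the tail deletes the smallest
-- element, as `ext` does.
countB-extAt : ∀ (ρ : Subset n → ℕ) A → countB (extAt ρ A) (allFin n) ≡ ext ρ A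
countB-extAt ρ [] = refl
countB-extAt ρ (b ∷ A) = trans (if-suc (extAt ρ (b ∷ A) zero) _) (trans
  (cong (𝟙 (extAt ρ (b ∷ A) zero) +_) (trans (countB-tabulate-suc (extAt ρ (b ∷ A)) (λ e → e)) (countB-extAt (ρ ∘ (false ∷_)) A)))
  (head b))
  where
  head : ∀ b → 𝟙 (extAt ρ (b ∷ A) zero) + ext (ρ ∘ (false ∷_)) A ≡ ext ρ (b ∷ A)
  head false = cong (λ B → 𝟙 (ρ (true ∷ B) ≡ᵇ ρ (false ∷ A)) + ext (ρ ∘ (false ∷_)) A) (∪-identityʳ A)
  head true  = refl

ε≡ext : ∀ (N : Matroid n) A → ε N A ≡ ext (rank N) A
ε≡ext N A = trans (countB-cong (inExt≡extAt N A) (allFin _)) (countB-extAt (rank N) A)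

-- Duality

∁-∪ : ∀ (A B : Subset n) → ∁ (A ∪ B) ≡ ∁ A ∩ ∁ B
∁-∪ []          []      = refl
∁-∪ (false ∷ A) (b ∷ B) = cong (not b ∷_) (∁-∪ A B)
∁-∪ (true ∷ A)  (b ∷ B) = cong (false ∷_) (∁-∪ A B)

∁-∩ : ∀ (A B : Subset n) → ∁ (A ∩ B) ≡ ∁ A ∪ ∁ B
∁-∩ []          []      = refl
∁-∩ (false ∷ A) (b ∷ B) = cong (true ∷_) (∁-∩ A B)
∁-∩ (true ∷ A)  (b ∷ B) = cong (not b ∷_) (∁-∩ A B)

∁-involutive : ∀ (A : Subset n) → ∁ (∁ A) ≡ A
∁-involutive []      = refl
∁-involutive (a ∷ A) = cong₂ _∷_ (not-involutive a) (∁-involutive A)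

∣∪∣+∣∩∣ : ∀ (A B : Subset n) → ∣ A ∪ B ∣ + ∣ A ∩ B ∣ ≡ ∣ A ∣ + ∣ B ∣
∣∪∣+∣∩∣ []          []          = refl
∣∪∣+∣∩∣ (false ∷ A) (false ∷ B) = ∣∪∣+∣∩∣ A B
∣∪∣+∣∩∣ (false ∷ A) (true ∷ B)  = trans (cong suc (∣∪∣+∣∩∣ A B)) (sym (ℕₚ.+-suc ∣ A ∣ ∣ B ∣))
∣∪∣+∣∩∣ (true ∷ A)  (false ∷ B) = cong suc (∣∪∣+∣∩∣ A B)
∣∪∣+∣∩∣ (true ∷ A)  (true ∷ B)  = cong suc (trans (ℕₚ.+-suc _ _) (trans (cong suc (∣∪∣+∣∩∣ A B)) (sym (ℕₚ.+-suc ∣ A ∣ ∣ B ∣))))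

∣∣+∣∁∣ : ∀ (A : Subset n) → ∣ A ∣ + ∣ ∁ A ∣ ≡ n
∣∣+∣∁∣ []          = refl
∣∣+∣∁∣ (false ∷ A) = trans (ℕₚ.+-suc ∣ A ∣ ∣ ∁ A ∣) (cong suc (∣∣+∣∁∣ A))
∣∣+∣∁∣ (true ∷ A)  = cong suc (∣∣+∣∁∣ A)

module _ (N : Matroid n) where

  private
    ρ : Subset n → ℕ
    ρ = rank N
    R : IsRank ρ
    R = rank-isRank N
    open ℕₚ.≤-Reasoning

  -- Unit increase from `∁ A` to `⊤`; it makes the truncated subtraction in `dualRank` exact.
  r≤∣∣+rank∁ : ∀ A → r N ≤ ∣ A ∣ + ρ (∁ A)
  r≤∣∣+rank∁ A = ℕₚ.+-cancelʳ-≤ ∣ ∁ A ∣ _ _ (begin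
    r N + ∣ ∁ A ∣                    ≤⟨ unit R ⊆⊤ ⟩
    ρ (∁ A) + ∣ ⊤ {n} ∣              ≡⟨ cong (ρ (∁ A) +_) (trans (∣⊤∣≡n n) (sym (∣∣+∣∁∣ A))) ⟩
    ρ (∁ A) + (∣ A ∣ + ∣ ∁ A ∣)    ≡⟨ swap (ρ (∁ A)) (∣ A ∣) (∣ ∁ A ∣) ⟩
    ∣ A ∣ + ρ (∁ A) + ∣ ∁ A ∣      ∎)
    where
    swap : ∀ a b c → a + (b + c) ≡ b + a + c
    swap = ℕ-Solver.solve-∀

  dualRank+r : ∀ A → dualRank N A + r N ≡ ∣ A ∣ + ρ (∁ A)
  dualRank+r A = ℕₚ.m∸n+n≡m (r≤∣∣+rank∁ A)

  private
    cancel-r : ∀ A B C D → (dualRank N A + r N) + (dualRank N B + r N) ≤ (dualRank N C + r N) + (dualRank N D + r N) →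
               dualRank N A + dualRank N B ≤ dualRank N C + dualRank N D
    cancel-r A B C D p = ℕₚ.+-cancelʳ-≤ (r N + r N) _ _ (subst₂ _≤_
      (+-interchange (dualRank N A) (r N) (dualRank N B) (r N)) (+-interchange (dualRank N C) (r N) (dualRank N D) (r N)) p)

  -- On complements the bound becomes monotonicity of `ρ`, monotonicity becomes unit increase, and
  -- submodularity stays itself with `∪` and `∩` exchanged.
  dual : Matroid n
  dual = record
    { rank        = dualRank N
    ; rank-bound  = λ A → ℕₚ.+-cancelʳ-≤ (r N) _ _ (begin
        dualRank N A + r N     ≡⟨ dualRank+r A ⟩
        ∣ A ∣ + ρ (∁ A)        ≤⟨ ℕₚ.+-monoʳ-≤ ∣ A ∣ (mono R ⊆⊤) ⟩
        ∣ A ∣ + r N            ∎)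
    ; rank-mono   = λ A B A⊆B → ℕₚ.∸-monoˡ-≤ (r N) (ℕₚ.+-cancelʳ-≤ (∣ ∁ A ∣ + ∣ ∁ B ∣) _ _ (begin
        ∣ A ∣ + ρ (∁ A) + (∣ ∁ A ∣ + ∣ ∁ B ∣)      ≡⟨ +-interchange (∣ A ∣) (ρ (∁ A)) (∣ ∁ A ∣) (∣ ∁ B ∣) ⟩
        ∣ A ∣ + ∣ ∁ A ∣ + (ρ (∁ A) + ∣ ∁ B ∣)
          ≤⟨ ℕₚ.+-monoʳ-≤ (∣ A ∣ + ∣ ∁ A ∣) (unit R (p⊆q⇒∁p⊇∁q A⊆B)) ⟩
        ∣ A ∣ + ∣ ∁ A ∣ + (ρ (∁ B) + ∣ ∁ A ∣)
          ≡⟨ cong (_+ (ρ (∁ B) + ∣ ∁ A ∣)) (trans (∣∣+∣∁∣ A) (sym (∣∣+∣∁∣ B))) ⟩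
        ∣ B ∣ + ∣ ∁ B ∣ + (ρ (∁ B) + ∣ ∁ A ∣)      ≡⟨ regroup (∣ B ∣) (∣ ∁ B ∣) (ρ (∁ B)) (∣ ∁ A ∣) ⟩
        ∣ B ∣ + ρ (∁ B) + (∣ ∁ A ∣ + ∣ ∁ B ∣)      ∎))
    ; rank-submod = λ A B → cancel-r (A ∪ B) (A ∩ B) A B (begin
        (dualRank N (A ∪ B) + r N) + (dualRank N (A ∩ B) + r N)
          ≡⟨ cong₂ _+_ (dualRank+r (A ∪ B)) (dualRank+r (A ∩ B)) ⟩
        (∣ A ∪ B ∣ + ρ (∁ (A ∪ B))) + (∣ A ∩ B ∣ + ρ (∁ (A ∩ B)))
          ≡⟨ +-interchange (∣ A ∪ B ∣) (ρ (∁ (A ∪ B))) (∣ A ∩ B ∣) (ρ (∁ (A ∩ B))) ⟩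
        (∣ A ∪ B ∣ + ∣ A ∩ B ∣) + (ρ (∁ (A ∪ B)) + ρ (∁ (A ∩ B)))
          ≡⟨ cong₂ _+_ (∣∪∣+∣∩∣ A B) (trans (cong₂ (λ X Y → ρ X + ρ Y) (∁-∪ A B) (∁-∩ A B)) (ℕₚ.+-comm (ρ (∁ A ∩ ∁ B)) _)) ⟩
        (∣ A ∣ + ∣ B ∣) + (ρ (∁ A ∪ ∁ B) + ρ (∁ A ∩ ∁ B))
          ≤⟨ ℕₚ.+-monoʳ-≤ (∣ A ∣ + ∣ B ∣) (submod R (∁ A) (∁ B)) ⟩
        (∣ A ∣ + ∣ B ∣) + (ρ (∁ A) + ρ (∁ B))
          ≡⟨ +-interchange (∣ A ∣) (∣ B ∣) (ρ (∁ A)) (ρ (∁ B)) ⟩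
        (∣ A ∣ + ρ (∁ A)) + (∣ B ∣ + ρ (∁ B))
          ≡⟨ cong₂ _+_ (dualRank+r A) (dualRank+r B) ⟨
        (dualRank N A + r N) + (dualRank N B + r N)                      ∎)
    }
    where
    regroup : ∀ a b c d → a + b + (c + d) ≡ a + c + (d + b)
    regroup = ℕ-Solver.solve-∀

≡ᵇ-sym : ∀ a b → (a ≡ᵇ b) ≡ (b ≡ᵇ a)
≡ᵇ-sym zero    zero    = refl
≡ᵇ-sym zero    (suc b) = refl
≡ᵇ-sym (suc a) zero    = refl
≡ᵇ-sym (suc a) (suc b) = ≡ᵇ-sym a b

-- The hypothesis is duality up to `c`, which will be r(N). It survives the recursion because
-- deleting the head in `σ` matches contracting it in `ρ`; the head leaves the rank `σ` unchanged
-- exactly when it raises `ρ`.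
ext-∁ : ∀ c (σ ρ : Subset n → ℕ) → (∀ A → σ (∁ A) + c ≡ ∣ ∁ A ∣ + ρ A) → ∀ A → ext σ (∁ A) ≡ int ρ A
ext-∁ c σ ρ eq []          = refl
ext-∁ c σ ρ eq (false ∷ A) = ext-∁ c (σ ∘ (false ∷_)) (ρ ∘ (true ∷_)) (eq ∘ (true ∷_)) A
ext-∁ c σ ρ eq (true ∷ A)  = cong₂ (λ b m → 𝟙 b + m) (begin
    (σ (true ∷ ∁ A) ≡ᵇ σ (false ∷ ∁ A))
  ≡⟨ ≡ᵇ-+ c _ _ ⟨
    (c + σ (true ∷ ∁ A) ≡ᵇ c + σ (false ∷ ∁ A))
  ≡⟨ cong₂ _≡ᵇ_ (trans (ℕₚ.+-comm c _) (trans (eq (false ∷ A)) (sym (ℕₚ.+-suc ∣ ∁ A ∣ _))))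
       (trans (ℕₚ.+-comm c _) (eq (true ∷ A))) ⟩
    (∣ ∁ A ∣ + suc (ρ (false ∷ A)) ≡ᵇ ∣ ∁ A ∣ + ρ (true ∷ A))
  ≡⟨ ≡ᵇ-+ ∣ ∁ A ∣ _ _ ⟩
    (suc (ρ (false ∷ A)) ≡ᵇ ρ (true ∷ A))
  ≡⟨ ≡ᵇ-sym (suc (ρ (false ∷ A))) (ρ (true ∷ A)) ⟩
    (ρ (true ∷ A) ≡ᵇ suc (ρ (false ∷ A))) ∎)
  (ext-∁ c (σ ∘ (false ∷_)) (ρ ∘ (true ∷_)) (eq ∘ (true ∷_)) A)
  where open ≡-Reasoning

inInt≡inExt-dual : ∀ (N : Matroid n) A e → inInt N A e ≡ inExt (dual N) (∁ A) e
inInt≡inExt-dual N A e rewrite lookup-map e not A | not-involutive (lookup A e) = refl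

ι≡int : ∀ (N : Matroid n) A → ι N A ≡ int (rank N) A
ι≡int N A = begin
  ι N A                      ≡⟨ countB-cong (inInt≡inExt-dual N A) (allFin _) ⟩
  ε (dual N) (∁ A)           ≡⟨ ε≡ext (dual N) (∁ A) ⟩
  ext (dualRank N) (∁ A)
    ≡⟨ ext-∁ (r N) (dualRank N) (rank N) (λ B → trans (dualRank+r N (∁ B)) (cong (λ C → ∣ ∁ B ∣ + rank N C) (∁-involutive B))) A ⟩
  int (rank N) A             ∎
  where open ≡-Reasoning

-- Perspectives in terms of rank

-- Reduces `quotient` to the addition of one element. The tail is enlarged while the head keeps its
-- value in A; the head is switched on last.
⊆-steps : ∀ {Q : Subset n → Subset n → Set} → (∀ {A} → Q A A) → (∀ {A B C} → Q A B → Q B C → Q A C) →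
          (∀ {S e} → e ∉ S → Q S (S ∪ ⁅ e ⁆)) → ∀ {A B} → A ⊆ B → Q A B
⊆-steps Q-refl Q-trans step {[]}    {[]}    A⊆B = Q-refl
⊆-steps {Q = Q} Q-refl Q-trans step {a ∷ A} {b ∷ B} A⊆B = Q-trans
  (⊆-steps {Q = λ S T → Q (a ∷ S) (a ∷ T)} Q-refl Q-trans
    (λ {S} {e} e∉S → subst (λ x → Q (a ∷ S) (x ∷ (S ∪ ⁅ e ⁆))) (∨-identityʳ a) (step (e∉S ∘ drop-there))) (drop-∷-⊆ A⊆B))
  (head a b A⊆B)
  where
  head : ∀ a b → a ∷ A ⊆ b ∷ B → Q (a ∷ B) (b ∷ B)
  head false false A⊆B = Q-refl
  head true  true  A⊆B = Q-refl
  head false true  A⊆B = subst (λ C → Q (false ∷ B) (true ∷ C)) (∪-identityʳ B) (step {e = zero} λ ())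
  head true  false A⊆B with () ← A⊆B here

-- If adding e raises the rank in M, it suffices that it raises the rank in M′ by at most one.
-- Otherwise e lies on a circuit of M within S ∪ {e}, and the perspective gives a circuit of M′
-- through e inside it, so the rank in M′ does not rise either.
perspective-rank : ∀ {M M′ : Matroid n} → Perspective M M′ → IsPerspective (rank M) (rank M′)
perspective-rank {n} {M} {M′} P = record
  { isRank   = rank-isRank M
  ; isRank′  = rank-isRank M′
  ; quotient = ⊆-steps {Q = Q} (λ {A} → ℕₚ.≤-reflexive (ℕₚ.+-comm (rank M′ A) (rank M A))) (λ {A} {B} {C} → Q-trans A B C) step
  }
  where
  Q : Subset n → Subset n → Set
  Q A B = rank M′ B + rank M A ≤ rank M B + rank M′ A

  Q-trans : ∀ A B C → Q A B → Q B C → Q A C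
  Q-trans A B C p q = ℕₚ.+-cancelʳ-≤ (rank M B + rank M′ B) _ _ (subst₂ _≤_
    (lemma₁ (rank M′ B) (rank M A) (rank M′ C) (rank M B)) (lemma₂ (rank M B) (rank M′ A) (rank M C) (rank M′ B)) (ℕₚ.+-mono-≤ p q))
    where
    lemma₁ : ∀ b′ a c′ b → b′ + a + (c′ + b) ≡ c′ + a + (b + b′)
    lemma₁ = ℕ-Solver.solve-∀
    lemma₂ : ∀ b a′ c b′ → b + a′ + (c + b′) ≡ c + a′ + (b + b′)
    lemma₂ = ℕ-Solver.solve-∀

  open ℕₚ.≤-Reasoning

  step : ∀ {S e} → e ∉ S → Q S (S ∪ ⁅ e ⁆)
  step {S} {e} e∉S with rank M (S ∪ ⁅ e ⁆) ℕₚ.≤? rank M S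
  ... | no ≰ = begin
    rank M′ (S ∪ ⁅ e ⁆) + rank M S              ≤⟨ ℕₚ.+-monoˡ-≤ (rank M S) (rank-∪ M′ S ⁅ e ⁆) ⟩
    rank M′ S + ∣ ⁅ e ⁆ ∣ + rank M S          ≡⟨ cong (λ m → rank M′ S + m + rank M S) (∣⁅x⁆∣≡1 e) ⟩
    rank M′ S + 1 + rank M S                  ≡⟨ lemma (rank M′ S) (rank M S) ⟩
    suc (rank M S) + rank M′ S                  ≤⟨ ℕₚ.+-monoˡ-≤ (rank M′ S) (ℕₚ.≰⇒> ≰) ⟩
    rank M (S ∪ ⁅ e ⁆) + rank M′ S              ∎
    where
    lemma : ∀ a b → a + 1 + b ≡ suc b + a
    lemma = ℕ-Solver.solve-∀
  ... | yes cl with C , circ , e∈C , C⊆ ← closure⇒circuit (rank-isRank M) (rank-⊥ M) e∉S cl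
    with C′ , circ′ , e∈C′ , C′⊆C ← P C (to T-≡ (IsCircuit⇒circuitR circ)) e e∈C = begin
    rank M′ (S ∪ ⁅ e ⁆) + rank M S
      ≤⟨ ℕₚ.+-monoˡ-≤ (rank M S) (circuit⇒closure (rank-isRank M′) (circuitR⇒IsCircuit (from T-≡ circ′)) e∈C′ (C⊆ ∘ C′⊆C)) ⟩
    rank M′ S + rank M S             ≡⟨ ℕₚ.+-comm (rank M′ S) (rank M S) ⟩
    rank M S + rank M′ S             ≤⟨ ℕₚ.+-monoˡ-≤ (rank M′ S) (rank-mono M S _ (p⊆p∪q ⁅ e ⁆)) ⟩
    rank M (S ∪ ⁅ e ⁆) + rank M′ S   ∎

-- Taylor expansion of the Tutte polynomial

Σₚ-++ : ∀ {A : Set} (xs ys : List A) (h : A → Poly) → Σₚ (xs ++ ys) h ≈ₚ (Σₚ xs h +ₚ Σₚ ys h)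
Σₚ-++ []       ys h i j k = sym (ℤₚ.+-identityˡ _)
Σₚ-++ (x ∷ xs) ys h i j k = trans (cong (λ s → h x i j k ℤ.+ s) (Σₚ-++ xs ys h i j k)) (sym (ℤₚ.+-assoc (h x i j k) _ _))

Σₚ-map : ∀ {A B : Set} (f : A → B) (xs : List A) (h : B → Poly) → Σₚ (map f xs) h ≈ₚ Σₚ xs (h ∘ f)
Σₚ-map f []       h i j k = refl
Σₚ-map f (x ∷ xs) h i j k = cong (λ s → h (f x) i j k ℤ.+ s) (Σₚ-map f xs h i j k)

Σₚ-subsets : ∀ n (h : Subset n → Poly) i j k → Σₚ (subsets n) h i j k ≡ ∑ n (λ A → h A i j k)
Σₚ-subsets zero    h i j k = ℤₚ.+-identityʳ _
Σₚ-subsets (suc n) h i j k = trans (Σₚ-++ (map (false ∷_) (subsets n)) (map (true ∷_) (subsets n)) h i j k) (cong₂ ℤ._+_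
  (trans (Σₚ-map (false ∷_) (subsets n) h i j k) (Σₚ-subsets n (h ∘ (false ∷_)) i j k))
  (trans (Σₚ-map (true ∷_) (subsets n) h i j k) (Σₚ-subsets n (h ∘ (true ∷_)) i j k)))

-- A derivative in x is traded for the next coefficient in u, termwise by `taylor-∂`; the factors
-- `suc p` build up p!.
∂x-lhs : ∀ {n} (ρ ρ′ : Subset n → ℕ) p q i j k → ℤ.+ suc i ℤ.* lhs ρ ρ′ p q (suc i) j k ≡ ℤ.+ suc p ℤ.* lhs ρ ρ′ (suc p) q i j k
∂x-lhs {n} ρ ρ′ p q i j k = trans (∑-*ˡ n (ℤ.+ suc i) (lhs-term ρ ρ′ p q (suc i) j k))
  (trans (∑-cong n λ A → pull (corank ρ′ A) (taylor (nullity ρ A) q j ℤ.* δ (codrop ρ ρ′ A) k))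
    (sym (∑-*ˡ n (ℤ.+ suc p) (lhs-term ρ ρ′ (suc p) q i j k))))
  where
  pull : ∀ m w → ℤ.+ suc i ℤ.* (taylor m p (suc i) ℤ.* w) ≡ ℤ.+ suc p ℤ.* (taylor m (suc p) i ℤ.* w)
  pull m w = trans (sym (ℤₚ.*-assoc (ℤ.+ suc i) (taylor m p (suc i)) w))
    (trans (cong (ℤ._* w) (taylor-∂ m p i)) (ℤₚ.*-assoc (ℤ.+ suc p) (taylor m (suc p) i) w))

∂y-lhs : ∀ {n} (ρ ρ′ : Subset n → ℕ) p q i j k → ℤ.+ suc j ℤ.* lhs ρ ρ′ p q i (suc j) k ≡ ℤ.+ suc q ℤ.* lhs ρ ρ′ p (suc q) i j k
∂y-lhs {n} ρ ρ′ p q i j k = trans (∑-*ˡ n (ℤ.+ suc j) (lhs-term ρ ρ′ p q i (suc j) k))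
  (trans (∑-cong n λ A → pull (taylor (corank ρ′ A) p i) (nullity ρ A) (δ (codrop ρ ρ′ A) k))
    (sym (∑-*ˡ n (ℤ.+ suc q) (lhs-term ρ ρ′ p (suc q) i j k))))
  where
  rotate : ∀ a b c d → a ℤ.* (b ℤ.* (c ℤ.* d)) ≡ b ℤ.* (a ℤ.* c ℤ.* d)
  rotate = solve-∀
  pull : ∀ v m w → ℤ.+ suc j ℤ.* (v ℤ.* (taylor m q (suc j) ℤ.* w)) ≡ ℤ.+ suc q ℤ.* (v ℤ.* (taylor m (suc q) j ℤ.* w))
  pull v m w = trans (rotate (ℤ.+ suc j) v (taylor m q (suc j)) w)
    (trans (cong (λ s → v ℤ.* (s ℤ.* w)) (taylor-∂ m q j)) (sym (rotate (ℤ.+ suc q) v (taylor m (suc q) j) w)))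

-- `d` is the factorial from the other variable: 1 while y is differentiated, then `q !` while x is.
next-! : ∀ c d x y p → c ℤ.* x ≡ ℤ.+ suc p ℤ.* y → c ℤ.* (ℤ.+ (p ! * d) ℤ.* x) ≡ ℤ.+ (suc p ! * d) ℤ.* y
next-! c d x y p eq = begin
  c ℤ.* (ℤ.+ (p ! * d) ℤ.* x)                 ≡⟨ swap c (ℤ.+ (p ! * d)) x ⟩
  ℤ.+ (p ! * d) ℤ.* (c ℤ.* x)                 ≡⟨ cong (ℤ.+ (p ! * d) ℤ.*_) eq ⟩
  ℤ.+ (p ! * d) ℤ.* (ℤ.+ suc p ℤ.* y)           ≡⟨ assoc (ℤ.+ (p ! * d)) (ℤ.+ suc p) y ⟩
  ℤ.+ suc p ℤ.* ℤ.+ (p ! * d) ℤ.* y             ≡⟨ cong (ℤ._* y) (ℤₚ.pos-* (suc p) (p ! * d)) ⟨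
  ℤ.+ (suc p * (p ! * d)) ℤ.* y           ≡⟨ cong (λ m → ℤ.+ m ℤ.* y) (ℕₚ.*-assoc (suc p) (p !) d) ⟨
  ℤ.+ (suc p ! * d) ℤ.* y                   ∎
  where
  open ≡-Reasoning
  swap : ∀ a b c → a ℤ.* (b ℤ.* c) ≡ b ℤ.* (a ℤ.* c)
  swap = solve-∀
  assoc : ∀ a b c → a ℤ.* (b ℤ.* c) ≡ b ℤ.* a ℤ.* c
  assoc = solve-∀

module _ {n} (M M′ : Matroid n) where

  private
    ρ ρ′ : Subset n → ℕ
    ρ  = rank M
    ρ′ = rank M′

  nullity≡nl : ∀ A → nullity ρ A ≡ nl M A
  nullity≡nl A = cong (_∸ ρ A) (trans (cong (∣ A ∣ +_) (rank-⊥ M)) (ℕₚ.+-identityʳ ∣ A ∣))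

  -- The exponents p = q = 0 amount to u = v = 0, and `taylor m 0` lists the coefficients of (x-1)ᵐ.
  tutte≡lhs : ∀ i j k → tutte M M′ i j k ≡ lhs ρ ρ′ 0 0 i j k
  tutte≡lhs i j k = trans (Σₚ-subsets n (λ A → ((X -ₚ 1ₚ) ^ₚ cr M′ A) *ₚ (((Y -ₚ 1ₚ) ^ₚ nl M A) *ₚ (Z ^ₚ rcd M M′ A))) i j k)
    (∑-cong n λ A → trans
    (sep-product {taylor (cr M′ A) 0} {taylor (nl M A) 0} {δ (rcd M M′ A)}
      ([X-1]^-sep (corank ρ′ A)) ([Y-1]^-sep (nl M A)) (Z^-sep (rcd M M′ A)) i j k)
    (cong (λ m → φ 0 0 i j k (corank ρ′ A) m (rcd M M′ A)) (sym (nullity≡nl A))))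

  ∂y-tutte : ∀ q i j k → iter q ∂y (tutte M M′) i j k ≡ ℤ.+ (q ! * 1) ℤ.* lhs ρ ρ′ 0 q i j k
  ∂y-tutte zero    i j k = trans (tutte≡lhs i j k) (sym (ℤₚ.*-identityˡ _))
  ∂y-tutte (suc q) i j k = trans (cong (ℤ.+ suc j ℤ.*_) (∂y-tutte q i (suc j) k)) (next-!
    (ℤ.+ suc j) 1 (lhs ρ ρ′ 0 q i (suc j) k) (lhs ρ ρ′ 0 (suc q) i j k) q
    (∂y-lhs ρ ρ′ 0 q i j k))

  ∂x∂y-tutte : ∀ p q i j k → iter p ∂x (iter q ∂y (tutte M M′)) i j k ≡ ℤ.+ (p ! * q !) ℤ.* lhs ρ ρ′ p q i j k
  ∂x∂y-tutte zero    q i j k = trans (∂y-tutte q i j k) (cong (λ m → ℤ.+ m ℤ.* lhs ρ ρ′ 0 q i j k) (ℕₚ.*-comm (q !) 1))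
  ∂x∂y-tutte (suc p) q i j k = trans (cong (ℤ.+ suc i ℤ.*_) (∂x∂y-tutte p q (suc i) j k)) (next-!
    (ℤ.+ suc i) (q !) (lhs ρ ρ′ p q (suc i) j k) (lhs ρ ρ′ (suc p) q i j k) p
    (∂x-lhs ρ ρ′ p q i j k))

  rhsSum≡rhs : ∀ p q i j k → rhsSum M M′ p q i j k ≡ rhs ρ ρ′ p q i j k
  rhsSum≡rhs p q i j k = trans (Σₚ-subsets n summand i j k) (∑-cong n term)
    where
    summand : Subset n → Poly
    summand A = if (cr M′ A ≡ᵇ p) ∧ (nl M A ≡ᵇ q)
                then (X ^ₚ ι M′ A) *ₚ ((Y ^ₚ ε M A) *ₚ (Z ^ₚ rcd M M′ A))
                else 0ₚ
    term : ∀ A → summand A i j k ≡ rhs-term ρ ρ′ p q i j k A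
    -- `δ-≡ᵇ` tests with the exponent p or q on the left, `rhsSum` with it on the right, hence the
    -- two symmetries.
    term A rewrite nullity≡nl A | ≡ᵇ-sym (cr M′ A) p | ≡ᵇ-sym (nl M A) q
                 | δ-≡ᵇ (corank ρ′ A) p | δ-≡ᵇ (nl M A) q with p ≡ᵇ cr M′ A | q ≡ᵇ nl M A
    ... | false | _     = refl
    ... | true  | false = refl
    ... | true  | true  = trans
      (sep-product {δ (ι M′ A)} {δ (ε M A)} {δ (rcd M M′ A)}
        (X^-sep (ι M′ A)) (Y^-sep (ε M A)) (Z^-sep (rcd M M′ A)) i j k)
      (trans (cong₂ (λ s t → δ s i ℤ.* (δ t j ℤ.* δ (rcd M M′ A) k)) (ι≡int M′ A) (ε≡ext M A))
        (sym (trans (ℤₚ.*-identityˡ _) (ℤₚ.*-identityˡ _))))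

open import Data.Integer using (+_)

theorem3 : (n : ℕ) (M M' : Matroid n) → Perspective M M' → (p q : ℕ) →
    iter p ∂x (iter q ∂y (tutte M M')) ≈ₚ ((+ ((p !) * (q !))) ·ₚ rhsSum M M' p q)
theorem3 n M M' P p q i j k = trans (∂x∂y-tutte M M' p q i j k) (cong (ℤ.+ (p ! * q !) ℤ.*_)
  (trans (lhs≡rhs n (perspective-rank {M = M} {M'} P) p q i j k) (sym (rhsSum≡rhs M M' p q i j k))))
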